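{- Let $\mathcal{RM}(\alpha_1,\ldots,\alpha_n)$ be a bi-rainbow meander, $n\ge1$, and let $m^*$, $L^*$, $R^*$ denote the index of the middle rainbow family and the total numbers of upper arcs in the families to its left and to its right. The number $\mathcal{Z}$ of connected components satisfies the following recursion (the first applicable case is used): $$\mathcal{Z}(\alpha_1,\ldots,\alpha_n)=\begin{cases} \mathcal{Z}(\alpha_1,\ldots,\alpha_{m^*-1},\alpha_{m^*+1},\ldots,\alpha_n)+\alpha_{m^*}, & L^*=R^*,\\ \mathcal{Z}(\alpha_1,\ldots,\alpha_{m^*-1},\alpha_{m^*+1},\ldots,\alpha_n), & |L^*-R^*|\ \text{divides}\ \alpha_{m^*},\\ \mathcal{Z}\bigl(\alpha_1,\ldots,\alpha_{m^*-1},\mathscr{R}(\alpha_{m^*},|L^*-R^*|),\alpha_{m^*+1},\ldots,\alpha_n\bigr), & \text{otherwise.} \end{cases}$$ Iterating this recursion (recomputing $m^*,L^*,R^*$ in every step) gives an algorithm that determines the number $\mathcal{Z}(\alpha_1,\ldots,\alpha_n)$ with logarithmic complexity $\mathcal{O}(b)\,\mathcal{O}(n)$, where $b=\sum_{\ell=1}^n\lceil\log_2(\alpha_\ell+1)\rceil$ is the number of bits needed to encode the input $(\alpha_1,\ldots,\alpha_n)$.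
   Context: For positive integers $\alpha_1,\ldots,\alpha_n$ put $\alpha=\sum_{\ell=1}^n\alpha_\ell$. The bi-rainbow meander $\mathcal{RM}(\alpha_1,\ldots,\alpha_n)$ is the planar configuration of arcs with endpoints at the points $1,2,\ldots,2\alpha$ of the horizontal axis, defined as follows. Above the axis there are $n$ rainbow families of nested arcs: with $s_\ell=2\sum_{k<\ell}\alpha_k$, the $\ell$-th family consists of the $\alpha_\ell$ arcs joining $s_\ell+i$ with $s_\ell+2\alpha_\ell+1-i$, $i=1,\ldots,\alpha_\ell$. Below the axis there is one rainbow family of $\alpha$ nested arcs, joining $k$ with $2\alpha+1-k$, $k=1,\ldots,\alpha$. The union of all upper and lower arcs is a disjoint union of closed Jordan curves; $\mathcal{Z}(\alpha_1,\ldots,\alpha_n)$ denotes the number of these curves (connected components). Equivalently, it is the number of orbits on $\{1,\ldots,2\alpha\}$ of the group generated by the two involutions given by the upper and by the lower arcs. $\mathcal{Z}$ of the empty tuple is $0$. Middle rainbow family: let $L(\ell)=\alpha_1+\cdots+\alpha_{\ell-1}$ for $1\le\ell\le n+1$ and $R(\ell)=\alpha_{\ell+1}+\cdots+\alpha_n$ for $1\le\ell\le n$. Then $m^*\in\{1,\ldots,n\}$ is the unique index with $L(m^*)<\alpha/2\le L(m^*+1)$, and $L^*=L(m^*)$, $R^*=R(m^*)$. $\mathscr{R}(a,c)$ denotes the remainder of the integer division $a/c$, $0\le\mathscr{R}(a,c)<c$. Complexity is measured by counting elementary integer operations (comparison, addition, subtraction, division with remainder), each assumed to cost $\mathcal{O}(1)$;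 the cost of arithmetic with large integers is not considered. -}

module Defs where

open import Data.Bool.Base using (Bool; if_then_else_)
open import Data.Fin.Base using (Fin; zero; suc; toℕ; punchIn; punchOut)
import Data.Fin.Properties as Fin
open import Data.List.Base
  using (List; []; _∷_; _++_; length; lookup; map; take; drop;
         removeAt; _[_]∷=_; allFin; cartesianProduct; filter)
open import Data.List.Membership.Propositional using (_∈_)
open import Data.List.Membership.Propositional.Properties
  using (∈-filter⁺; ∈-filter⁻; ∈-cartesianProduct⁺; ∈-allFin)
open import Data.List.Relation.Unary.All using (All; []; _∷_)
open import Data.List.Relation.Unary.Any using (here; there)
open import Data.Nat.Base
open import Data.Nat.Divisibility using (_∣_; _∣?_)
open import Data.Nat.DivMod using (_/_; _%_)
open import Data.Nat.ListAction using (sum)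
open import Data.Nat.Logarithm using (⌈log₂_⌉)
open import Data.Nat.Properties
  using (_≟_; _≤?_; anyUpTo?; ∣m-n∣≡0⇒m≡n; m≤m+n; +-monoʳ-≤;
         *-monoʳ-≤; +-identityʳ; +-assoc; <⇒≱; ≰⇒>; ≮⇒≥; ≤-trans; ≤-antisym)
open import Data.Product using (∃; ∃!; ∃-syntax; _×_; _,_; proj₁; proj₂)
open import Data.Sum.Base using (_⊎_; inj₁; inj₂)
open import Function.Base using (id; _∘_)
open import Function.Bundles using (Bijection)
open import Level using (0ℓ)
open import Relation.Binary.Construct.Closure.Equivalence as Eq using (EqClosure)
open import Relation.Binary.Construct.Closure.ReflexiveTransitive using (ε; _◅_; _◅◅_)
open import Relation.Binary.Construct.Closure.Symmetric using (fwd; bwd)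
import Relation.Binary.Construct.On as On
open import Relation.Binary.Core using (Rel)
open import Relation.Binary.Definitions using (Decidable)
open import Relation.Binary.PropositionalEquality
  using (_≡_; _≢_; refl; sym; trans; cong; subst; isEquivalence; setoid)
open import Relation.Nullary.Decidable using (Dec; yes; no; _×-dec_; _⊎-dec_; map′)
open import Relation.Nullary.Negation using (contradiction)

------------------------------------------------------------------------
-- Connected components of a finite graph

-- The finite graph R has k connected components when the classes of the
-- equivalence generated by R are in bijection with Fin k.

HasComponents : ∀ {N} → Rel (Fin N) 0ℓ → ℕ → Set
HasComponents R k = Bijection (Eq.setoid R) (setoid (Fin k))

private

  Listed : ∀ {N} → List (Fin N × Fin N) → Rel (Fin N) 0ℓ
  Listed es x y = (x , y) ∈ es

  record Merge {k} (a b : Fin k) : Set where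
    field
      {size}     : ℕ
      to         : Fin k → Fin size
      identifies : to a ≡ to b
      kernel     : ∀ {x y} → to x ≡ to y →
                   x ≡ y ⊎ (x ≡ a × y ≡ b) ⊎ (x ≡ b × y ≡ a)
      section    : ∀ y → ∃[ x ] to x ≡ y

  merge : ∀ {k} (a b : Fin k) → a ≢ b → Merge a b
  merge {suc k} a b a≢b = record
    { to = to ; identifies = identifies ; kernel = kernel ; section = section }
    where
    to : Fin (suc k) → Fin k
    to x with a Fin.≟ x
    ... | yes _   = punchOut a≢b
    ... | no  a≢x = punchOut a≢x

    identifies : to a ≡ to b
    identifies with a Fin.≟ a | a Fin.≟ b
    ... | no a≢a | _       = contradiction refl a≢a
    ... | yes _  | yes a≡b = contradiction a≡b a≢b
    ... | yes _  | no  _   = Fin.punchOut-cong a refl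

    kernel : ∀ {x y} → to x ≡ to y →
             x ≡ y ⊎ (x ≡ a × y ≡ b) ⊎ (x ≡ b × y ≡ a)
    kernel {x} {y} eq with a Fin.≟ x | a Fin.≟ y
    ... | yes a≡x | yes a≡y = inj₁ (trans (sym a≡x) a≡y)
    ... | yes a≡x | no  a≢y =
      inj₂ (inj₁ (sym a≡x , sym (Fin.punchOut-injective a≢b a≢y eq)))
    ... | no  a≢x | yes a≡y =
      inj₂ (inj₂ (Fin.punchOut-injective a≢x a≢b eq , sym a≡y))
    ... | no  a≢x | no  a≢y = inj₁ (Fin.punchOut-injective a≢x a≢y eq)

    section : ∀ y → ∃[ x ] to x ≡ y
    section y = punchIn a y , eq
      where
      eq : to (punchIn a y) ≡ y
      eq with a Fin.≟ punchIn a y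
      ... | yes a≡p = contradiction (sym a≡p) (Fin.punchInᵢ≢i a y)
      ... | no  _   = trans (Fin.punchOut-cong a refl) (Fin.punchOut-punchIn a)

  listedComponents : ∀ {N} (es : List (Fin N × Fin N)) → ∃ (HasComponents (Listed es))
  listedComponents {N} [] = N , record
    { to        = id
    ; cong      = Eq.fold isEquivalence (λ ())
    ; bijective = (λ { refl → ε })
                , λ y → y , Eq.fold isEquivalence (λ ())
    }
  listedComponents ((u , v) ∷ es) with listedComponents es
  ... | k , B with Bijection.to B u Fin.≟ Bijection.to B v
  ...   | yes fu≡fv = k , record
    { to        = f
    ; cong      = f-cong
    ; bijective = (λ eq → Eq.map there (Bijection.injective B eq))
                , λ y → let (x , p) = Bijection.surjective B y
                        in x , λ z~x → trans (f-cong z~x) (p ε)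
    }
    where
    f = Bijection.to B
    f-cong : ∀ {x y} → EqClosure (Listed ((u , v) ∷ es)) x y → f x ≡ f y
    f-cong = Eq.gfold isEquivalence f λ
      { (here refl) → fu≡fv
      ; (there e)   → Bijection.cong B (fwd e ◅ ε)
      }
  ...   | no fu≢fv = Merge.size M , record
    { to        = g
    ; cong      = g-cong
    ; bijective = g-injective
                , λ y → let (j , q) = Merge.section M y
                            (x , p) = Bijection.surjective B j
                        in x , λ z~x → trans (g-cong z~x) (trans (cong (Merge.to M) (p ε)) q)
    }
    where
    f = Bijection.to B
    M = merge (f u) (f v) fu≢fv
    g = Merge.to M ∘ f
    g-cong : ∀ {x y} → EqClosure (Listed ((u , v) ∷ es)) x y → g x ≡ g y
    g-cong = Eq.gfold isEquivalence g λ
      { (here refl) → Merge.identifies M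
      ; (there e)   → cong (Merge.to M) (Bijection.cong B (fwd e ◅ ε))
      }
    lift : ∀ {x y} → f x ≡ f y → EqClosure (Listed ((u , v) ∷ es)) x y
    lift eq = Eq.map there (Bijection.injective B eq)
    g-injective : ∀ {x y} → g x ≡ g y → EqClosure (Listed ((u , v) ∷ es)) x y
    g-injective eq with Merge.kernel M eq
    ... | inj₁ fx≡fy            = lift fx≡fy
    ... | inj₂ (inj₁ (xu , yv)) = lift xu ◅◅ fwd (here refl) ◅ lift (sym yv)
    ... | inj₂ (inj₂ (xv , yu)) = lift xv ◅◅ bwd (here refl) ◅ lift (sym yu)

  edges : ∀ {N} {R : Rel (Fin N) 0ℓ} → Decidable R → List (Fin N × Fin N)
  edges R? = filter (λ (x , y) → R? x y) (cartesianProduct (allFin _) (allFin _))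

components : ∀ {N} (R : Rel (Fin N) 0ℓ) → Decidable R → ∃ (HasComponents R)
components R R? with listedComponents (edges R?)
... | k , B = k , record
  { to        = Bijection.to B
  ; cong      = λ x~y → Bijection.cong B (Eq.map listed x~y)
  ; bijective = (λ eq → Eq.map sound (Bijection.injective B eq))
              , λ y → let (x , p) = Bijection.surjective B y
                      in x , λ z~x → p (Eq.map listed z~x)
  }
  where
  listed : ∀ {x y} → R x y → Listed (edges R?) x y
  listed r = ∈-filter⁺ (λ (x , y) → R? x y) (∈-cartesianProduct⁺ (∈-allFin _) (∈-allFin _)) r
  sound : ∀ {x y} → Listed (edges R?) x y → R x y
  sound e = proj₂ (∈-filter⁻ (λ (x , y) → R? x y) {xs = cartesianProduct (allFin _) (allFin _)} e)

------------------------------------------------------------------------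
-- Bi-rainbow meanders

-- Families are indexed by Fin n, so the family m of the code is the family
-- ℓ = toℕ m + 1 of the usual numbering; end points keep the numbering
-- 1, …, 2α.

-- s_ℓ = 2 ∑_{k<ℓ} α_k
offset : (αs : List ℕ) → Fin (length αs) → ℕ
offset αs ℓ = 2 * sum (take (toℕ ℓ) αs)

UpperArc : List ℕ → Rel ℕ 0ℓ
UpperArc αs a b = ∃[ ℓ ] ∃[ i ] 1 ≤ i × i ≤ lookup αs ℓ
  × a ≡ offset αs ℓ + i × b ≡ offset αs ℓ + 2 * lookup αs ℓ + 1 ∸ i

LowerArc : List ℕ → Rel ℕ 0ℓ
LowerArc αs a b = ∃[ k ] 1 ≤ k × k ≤ sum αs
  × a ≡ k × b ≡ 2 * sum αs + 1 ∸ k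

position : ∀ {N} → Fin N → ℕ
position p = suc (toℕ p)

Arc : (αs : List ℕ) → Rel (Fin (2 * sum αs)) 0ℓ
Arc αs p q = UpperArc αs (position p) (position q) ⊎ LowerArc αs (position p) (position q)

private

  boundedAny? : ∀ {P : ℕ → Set} → (∀ i → Dec (P i)) → ∀ v →
                Dec (∃[ i ] 1 ≤ i × i ≤ v × P i)
  boundedAny? P? v = map′
    (λ { (i , s≤s i≤v , 1≤i , p) → i , 1≤i , i≤v , p })
    (λ { (i , 1≤i , i≤v , p) → i , s≤s i≤v , 1≤i , p })
    (anyUpTo? (λ i → (1 ≤? i) ×-dec P? i) (suc v))

upperArc? : ∀ αs → Decidable (UpperArc αs)
upperArc? αs a b = Fin.any? λ ℓ → boundedAny?
  (λ i → (a ≟ offset αs ℓ + i) ×-dec (b ≟ offset αs ℓ + 2 * lookup αs ℓ + 1 ∸ i))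
  (lookup αs ℓ)

lowerArc? : ∀ αs → Decidable (LowerArc αs)
lowerArc? αs a b =
  boundedAny? (λ k → (a ≟ k) ×-dec (b ≟ 2 * sum αs + 1 ∸ k)) (sum αs)

arc? : ∀ αs → Decidable (Arc αs)
arc? αs p q =
  upperArc? αs (position p) (position q) ⊎-dec lowerArc? αs (position p) (position q)

-- Each curve is the union of the arcs whose end points form one class, so
-- the curves are counted by the classes of end points.
𝒵 : List ℕ → ℕ
𝒵 αs = proj₁ (components (Arc αs) (arc? αs))

------------------------------------------------------------------------
-- The middle rainbow family and the recursion

leftOf : (αs : List ℕ) → Fin (length αs) → ℕ
leftOf αs m = sum (take (toℕ m) αs)

rightOf : (αs : List ℕ) → Fin (length αs) → ℕ
rightOf αs m = sum (drop (suc (toℕ m)) αs)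

-- L(m) < α/2 ≤ L(m+1), multiplied by two
IsMiddle : (αs : List ℕ) → Fin (length αs) → Set
IsMiddle αs m = 2 * leftOf αs m < sum αs × sum αs ≤ 2 * sum (take (suc (toℕ m)) αs)

private

  prefix-mono : ∀ {i j} xs → i ≤ j → sum (take i xs) ≤ sum (take j xs)
  prefix-mono xs       z≤n       = z≤n
  prefix-mono []       (s≤s i≤j) = z≤n
  prefix-mono (x ∷ xs) (s≤s i≤j) = +-monoʳ-≤ x (prefix-mono xs i≤j)

  crossing : ∀ T p xs → 2 * p < T → T ≤ 2 * (p + sum xs) →
             ∃[ m ] 2 * (p + sum (take (toℕ {length xs} m) xs)) < T
                  × T ≤ 2 * (p + sum (take (suc (toℕ m)) xs))
  crossing T p []       lo hi =
    contradiction (subst (λ q → T ≤ 2 * q) (+-identityʳ p) hi) (<⇒≱ lo)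
  crossing T p (x ∷ xs) lo hi with T ≤? 2 * (p + (x + 0))
  ... | yes T≤ = zero , subst (λ q → 2 * q < T) (sym (+-identityʳ p)) lo , T≤
  ... | no  T≰ with crossing T (p + x) xs
                    (subst (λ q → 2 * (p + q) < T) (+-identityʳ x) (≰⇒> T≰))
                    (subst (λ q → T ≤ 2 * q) (sym (+-assoc p x _)) hi)
  ...   | m , lo′ , hi′ = suc m
    , subst (λ q → 2 * q < T) (+-assoc p x _) lo′
    , subst (λ q → T ≤ 2 * q) (+-assoc p x _) hi′

  notAfter : ∀ αs {m m′} → IsMiddle αs m → IsMiddle αs m′ → toℕ m′ ≤ toℕ m
  notAfter αs {m} {m′} (_ , hi) (lo′ , _) = ≮⇒≥ λ m<m′ →
    <⇒≱ lo′ (≤-trans hi (*-monoʳ-≤ 2 (prefix-mono αs m<m′)))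

-- m* is well defined.
existsUniqueMiddle : ∀ αs → All NonZero αs → 1 ≤ length αs → ∃! _≡_ (IsMiddle αs)
existsUniqueMiddle []       _         ()
existsUniqueMiddle (α ∷ αs) (α≢0 ∷ _) _
  with crossing (sum (α ∷ αs)) 0 (α ∷ αs)
         (≤-trans (>-nonZero⁻¹ α {{α≢0}}) (m≤m+n α _)) (m≤m+n _ _)
... | m , middle = m , middle , λ middle′ → Fin.toℕ-injective
  (≤-antisym (notAfter (α ∷ αs) middle′ middle) (notAfter (α ∷ αs) middle middle′))

-- The right-hand side of the recursion in the form 𝒵(βs) + d, as the pair
-- (βs , d).
reduce : (αs : List ℕ) → Fin (length αs) → List ℕ × ℕ
reduce αs m with leftOf αs m ≟ rightOf αs m
... | yes _ = removeAt αs m , lookup αs m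
... | no L≢R with ∣ leftOf αs m - rightOf αs m ∣ ∣? lookup αs m
...   | yes _ = removeAt αs m , 0
...   | no  _ = αs [ m ]∷= (lookup αs m % ∣ leftOf αs m - rightOf αs m ∣) , 0
  where instance
  difference≢0 : NonZero ∣ leftOf αs m - rightOf αs m ∣
  difference≢0 = ≢-nonZero (L≢R ∘ ∣m-n∣≡0⇒m≡n)

------------------------------------------------------------------------
-- Programs over elementary integer operations

-- A program written for an arbitrary type I of integers can inspect or
-- produce integers only through the operations below.
data Program (I A : Set) : Set where
  return : A → Program I A
  less   : I → I → (Bool → Program I A) → Program I A
  equal  : I → I → (Bool → Program I A) → Program I A
  plus   : I → I → (I → Program I A) → Program I A
  minus  : I → I → (I → Program I A) → Program I A
  divide : I → I → (I × I → Program I A) → Program I A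

_>>=_ : ∀ {I A B} → Program I A → (A → Program I B) → Program I B
return a     >>= f = f a
less x y k   >>= f = less x y λ b → k b >>= f
equal x y k  >>= f = equal x y λ b → k b >>= f
plus x y k   >>= f = plus x y λ z → k z >>= f
minus x y k  >>= f = minus x y λ z → k z >>= f
divide x y k >>= f = divide x y λ qr → k qr >>= f

-- p ⇓ a ⟨ c ⟩ : p returns a after exactly c operations. Subtractions with a
-- negative result and divisions by zero get stuck.
data _⇓_⟨_⟩ {A : Set} : Program ℕ A → A → ℕ → Set where
  return : ∀ {a} → return a ⇓ a ⟨ 0 ⟩
  less   : ∀ {x y k a c} → k (x <ᵇ y) ⇓ a ⟨ c ⟩ → less x y k ⇓ a ⟨ suc c ⟩
  equal  : ∀ {x y k a c} → k (x ≡ᵇ y) ⇓ a ⟨ c ⟩ → equal x y k ⇓ a ⟨ suc c ⟩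
  plus   : ∀ {x y k a c} → k (x + y) ⇓ a ⟨ c ⟩ → plus x y k ⇓ a ⟨ suc c ⟩
  minus  : ∀ {x y k a c} → y ≤ x → k (x ∸ y) ⇓ a ⟨ c ⟩ → minus x y k ⇓ a ⟨ suc c ⟩
  divide : ∀ {x y k a c} .{{_ : NonZero y}} →
           k (x / y , x % y) ⇓ a ⟨ c ⟩ → divide x y k ⇓ a ⟨ suc c ⟩

-- Repeat the body until it exits through inj₁.
data Loop {S B : Set} (body : S → Program ℕ (B ⊎ S)) : S → B → ℕ → Set where
  exit : ∀ {s b c} → body s ⇓ inj₁ b ⟨ c ⟩ → Loop body s b c
  next : ∀ {s t b c d} → body s ⇓ inj₂ t ⟨ c ⟩ → Loop body t b d → Loop body s b (c + d)

------------------------------------------------------------------------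
-- The algorithm

module Algorithm {I : Set} (0# : I) where

  _⊕_ _⊖_ : I → I → Program I I
  x ⊕ y = plus x y return
  x ⊖ y = minus x y return

  _⋖_ _≐_ : I → I → Program I Bool
  x ⋖ y = less x y return
  x ≐ y = equal x y return

  _divMod_ : I → I → Program I (I × I)
  x divMod y = divide x y return

  total : List I → Program I I
  total []       = return 0#
  total (x ∷ xs) = do
    s ← total xs
    x ⊕ s

  distance : I → I → Program I I
  distance x y = do
    b ← x ⋖ y
    if b then y ⊖ x else x ⊖ y

  -- Given α and the sum L of the families already passed, find the first
  -- family a among x ∷ xs with α ≤ 2(L + a); the result consists of the
  -- families passed, the new value of L, a, and the families after a. The
  -- last family needs no test.
  findMiddle : I → I → I → List I → Program I (List I × I × I × List I)
  findMiddle α L x []       = return ([] , L , x , [])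
  findMiddle α L x (y ∷ ys) = do
    L′ ← L ⊕ x
    D  ← L′ ⊕ L′
    b  ← D ⋖ α
    if b
      then (do
        ls , M , a , rs ← findMiddle α L′ y ys
        return (x ∷ ls , M , a , rs))
      else return ([] , L , x , y ∷ ys)

  -- The state (αs , z) stands for the value 𝒵(αs) + z.
  step : List I × I → Program I (I ⊎ (List I × I))
  step ([]     , z) = return (inj₁ z)
  step (x ∷ xs , z) = do
    α ← total (x ∷ xs)
    ls , L , a , rs ← findMiddle α 0# x xs
    M ← L ⊕ a
    R ← α ⊖ M
    balanced ← L ≐ R
    if balanced
      then (do
        z′ ← z ⊕ a
        return (inj₂ (ls ++ rs , z′)))
      else (do
        d ← distance L R
        _ , r ← a divMod d
        divisible ← r ≐ 0#
        if divisible
          then return (inj₂ (ls ++ rs , z))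
          else return (inj₂ (ls ++ r ∷ rs , z)))

open Algorithm 0 using (step) public

-- Computes αs z c : started on αs, the algorithm halts with result z after
-- c operations in total.
Computes : List ℕ → ℕ → ℕ → Set
Computes αs z c = Loop step (αs , 0) z c

-- b = ∑ ⌈log₂(α_ℓ + 1)⌉
bits : List ℕ → ℕ
bits αs = sum (map (λ a → ⌈log₂ suc a ⌉) αs)

{-# OPTIONS --safe #-}
module Submission where

-- Let d = |L − R| for a chosen family with a arcs. On the block of end points
-- between the outer families, the lower involution after the upper one is the
-- translation by ± 2d, so points at distance 2d inside the family lie on one
-- curve and the first (or last) 2d of them can be contracted without changing
-- the classes: 𝒵 depends on a only modulo d. If d = 0, the two involutions
-- agree on the family, and each of its arcs closes up to a curve of its own.
--
-- For the middle family d ≤ a, hence a mod d < a / 2: every pass removes at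
-- least one bit, and it costs O(n) operations.

open import Defs
open import Data.Empty using (⊥)
open import Data.Fin.Base using (Fin; toℕ; fromℕ<)
import Data.Fin.Properties as Fin
open import Data.List.Base
  using (List; []; _∷_; _++_; length; lookup; take; drop; removeAt; _[_]∷=_)
open import Data.List.Relation.Unary.All using (All)
open import Data.Nat.Base
open import Data.Nat.Divisibility using (_∣?_; n∣m⇒m%n≡0; m%n≡0⇒n∣m)
open import Data.Nat.DivMod using (m≡m%n+[m/n]*n; m%n<n; m≥n⇒m/n>0)
open import Data.Nat.ListAction using (sum)
open import Data.Nat.ListAction.Properties using (sum-++)
open import Data.Nat.Logarithm using (⌈log₂_⌉; ⌈log₂⌉-mono-≤; ⌈log₂2*n⌉≡1+⌈log₂n⌉)
open import Data.Nat.Properties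
open import Data.Nat.Tactic.RingSolver using (solve-∀; solve)
open import Data.Product.Base using (∃-syntax; _×_; _,_; proj₁; proj₂)
open import Data.Sum.Base using (_⊎_; inj₁; inj₂)
open import Function.Base using (_∘_)
open import Function.Bundles using (Bijection)
open import Level using (0ℓ)
open import Relation.Binary.Construct.Closure.Equivalence as Eq using (EqClosure)
open import Relation.Binary.Construct.Closure.ReflexiveTransitive using (ε; _◅◅_)
open import Relation.Binary.Core using (Rel)
open import Relation.Binary.PropositionalEquality
  using (_≡_; _≢_; refl; sym; trans; cong; cong₂; subst; subst₂; isEquivalence; module ≡-Reasoning)
open import Relation.Nullary.Decidable using (yes; no; dec-true; dec-false)
open import Relation.Nullary.Negation using (contradiction)

-- Graphs on the points 1, …, N

-- `𝒵` is read off a computed bijection between classes of points of `Fin N` and some `Fin k`, and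
-- `N` changes with every step of the recursion. So a labelling of the reduced configuration is
-- carried over to the original one, and uniqueness of the number of labels identifies that number
-- with `𝒵`. Points are plain numbers with range conditions and arcs are given by the sums of their
-- end points: moving points is then linear arithmetic, without casts between `Fin` types.
--
-- Contraction must not disturb the arcs outside the chosen family. Those on its left keep their
-- coordinates, those on its right would be shifted unless they are counted from the right end. With
-- this convention `P` and `Q` can be arbitrary relations, and the case of a longer left side is the
-- mirror image of the other one.

InRange : ℕ → ℕ → Set
InRange N p = 0 < p × p ≤ N

≡⇒~ : ∀ {E : Rel ℕ 0ℓ} {p q} → p ≡ q → EqClosure E p q
≡⇒~ refl = ε

-- A form of `HasComponents` on plain numbers: the classes of the points 1, ..., N are numbered by
-- 0, ..., k - 1. Graphs with different `N` can share coordinates this way.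
record Labelling (N : ℕ) (E : Rel ℕ 0ℓ) (k : ℕ) : Set where
  field
    label    : ℕ → ℕ
    bounded  : ∀ {p} → InRange N p → label p < k
    sound    : ∀ {p q} → E p q → label p ≡ label q
    complete : ∀ {p q} → InRange N p → InRange N q → label p ≡ label q → EqClosure E p q
    onto     : ∀ {i} → i < k → ∃[ p ] InRange N p × label p ≡ i

  sound* : ∀ {p q} → EqClosure E p q → label p ≡ label q
  sound* = Eq.gfold isEquivalence label sound

private
  -- Each label of `A` is realised at some point. The `B`-labels of these points are distinct, since
  -- points with the same `B`-label are connected and hence have the same `A`-label.
  labelling-≤ : ∀ {N E k k′} → Labelling N E k → Labelling N E k′ → k ≤ k′
  labelling-≤ {N} {E} {k} {k′} A B = Fin.injective⇒≤ {f = f} f-injective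
    where
    module A = Labelling A
    module B = Labelling B
    point : ∀ (i : Fin k) → ∃[ p ] InRange N p × A.label p ≡ toℕ i
    point i = A.onto (Fin.toℕ<n i)
    f : Fin k → Fin k′
    f i = fromℕ< (B.bounded (proj₁ (proj₂ (point i))))
    f-injective : ∀ {i j} → f i ≡ f j → i ≡ j
    f-injective {i} {j} eq with point i | point j
    ... | p , p∈ , p≡i | q , q∈ , q≡j = Fin.toℕ-injective (trans (sym p≡i) (trans
      (A.sound* (B.complete p∈ q∈ (Fin.fromℕ<-injective _ _ _ _ eq))) q≡j))

labelling-unique : ∀ {N E k k′} → Labelling N E k → Labelling N E k′ → k ≡ k′
labelling-unique A B = ≤-antisym (labelling-≤ A B) (labelling-≤ B A)

-- The maps are inverse only up to connectedness, and an edge may go to a path: contraction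
-- identifies points, and one arc may have to be replaced by several.
record Equivalence (N : ℕ) (E : Rel ℕ 0ℓ) (N′ : ℕ) (E′ : Rel ℕ 0ℓ) : Set where
  field
    to         : ℕ → ℕ
    from       : ℕ → ℕ
    to-range   : ∀ {p} → InRange N p → InRange N′ (to p)
    from-range : ∀ {q} → InRange N′ q → InRange N (from q)
    to-edge    : ∀ {p q} → E p q → EqClosure E′ (to p) (to q)
    from-edge  : ∀ {p q} → E′ p q → EqClosure E (from p) (from q)
    from-to    : ∀ {p} → InRange N p → EqClosure E (from (to p)) p
    to-from    : ∀ {q} → InRange N′ q → EqClosure E′ (to (from q)) q

relabel : ∀ {N E N′ E′ k} → Equivalence N E N′ E′ → Labelling N′ E′ k → Labelling N E k
relabel {E = E} F A = record
  { label    = label ∘ to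
  ; bounded  = bounded ∘ to-range
  ; sound    = sound* ∘ to-edge
  ; complete = λ p∈ q∈ eq →
      Eq.symmetric E (from-to p∈)
      ◅◅ Eq.gfold (Eq.isEquivalence E) from from-edge (complete (to-range p∈) (to-range q∈) eq)
      ◅◅ from-to q∈
  ; onto     = λ i<k → let (q , q∈ , q≡i) = onto i<k in
      from q , from-range q∈ , trans (sound* (to-from q∈)) q≡i
  }
  where
  open Equivalence F
  open Labelling A

sameEdges : ∀ {N E E′} → (∀ {p q} → E p q → E′ p q) → (∀ {p q} → E′ p q → E p q) →
            Equivalence N E N E′
sameEdges f g = record
  { to = λ p → p ; from = λ p → p
  ; to-range = λ r → r ; from-range = λ r → r
  ; to-edge = Eq.return ∘ f ; from-edge = Eq.return ∘ g
  ; from-to = λ _ → ε ; to-from = λ _ → ε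
  }

-- Configurations seen from one rainbow

Opposite : ℕ → Rel ℕ 0ℓ
Opposite N p p′ = p + p′ ≡ suc N

-- The sum condition makes the relation symmetric and free of subtraction, and the two lower bounds
-- imply the upper ones. The lower rainbow has the same shape, with `o` = 0 and all points as its
-- end points.
Link : ℕ → ℕ → Rel ℕ 0ℓ
Link o n p q = o < p × o < q × Opposite (o + o + n) p q

-- The rainbow has n end points and starts after ℓ points; P holds the upper arcs
-- to its left. Those to its right are the arcs of Q with points counted from
-- the right, so that reflecting the axis just exchanges P and Q.
data Edge (N ℓ n : ℕ) (P Q : Rel ℕ 0ℓ) (p q : ℕ) : Set where
  left   : P p q → Edge N ℓ n P Q p q
  middle : Link ℓ n p q → Edge N ℓ n P Q p q
  right  : ∀ {p′ q′} → Opposite N p p′ → Opposite N q q′ → Q p′ q′ → Edge N ℓ n P Q p q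
  lower  : Link 0 N p q → Edge N ℓ n P Q p q

Within : ℕ → Rel ℕ 0ℓ → Set
Within b P = ∀ {p q} → P p q → p ≤ b × q ≤ b

link-sym : ∀ {o n p q} → Link o n p q → Link o n q p
link-sym {p = p} {q} (o<p , o<q , eq) = o<q , o<p , trans (+-comm q p) eq

complement-< : ∀ {p q} u v w → p + q ≡ suc (u + v + w) → p ≤ u → v < q
complement-< {p} {q} u v w eq p≤u = +-cancelˡ-< p v q (begin-strict
  p + v         ≤⟨ +-monoˡ-≤ v p≤u ⟩
  u + v         ≤⟨ m≤m+n (u + v) w ⟩
  u + v + w     <⟨ n<1+n _ ⟩
  suc (u + v + w) ≡⟨ sym eq ⟩
  p + q         ∎)
  where open ≤-Reasoning

complement-≤ : ∀ {p q} u v → p + q ≡ u + v → u ≤ p → q ≤ v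
complement-≤ {p} {q} u v eq u≤p =
  +-cancelˡ-≤ u q v (≤-trans (+-monoˡ-≤ q u≤p) (≤-reflexive eq))

opposite-unique : ∀ N p p′ → Opposite N p p′ → suc N ∸ p ≡ p′
opposite-unique N p p′ eq = trans (cong (_∸ p) (sym eq)) (m+n∸m≡n p p′)

-- The two reflections add up to a formula for p + q + p′ + q′, from which the known sum p + q
-- cancels.
link-mirror : ∀ o n s {p q p′ q′} → Opposite (o + n + s) p p′ → Opposite (o + n + s) q q′ →
              Link o n p q → Link s n p′ q′
link-mirror o n s {p} {q} {p′} {q′} pp′ qq′ (o<p , o<q , pq) =
    far (trans (+-comm q p) pq) o<q pp′
  , far pq o<p qq′
  , +-cancelˡ-≡ (p + q) _ _ (begin
      p + q + (p′ + q′)                 ≡⟨ solve (p ∷ q ∷ p′ ∷ q′ ∷ []) ⟩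
      (p + p′) + (q + q′)               ≡⟨ cong₂ _+_ pp′ qq′ ⟩
      suc (o + n + s) + suc (o + n + s) ≡⟨ solve (o ∷ n ∷ s ∷ []) ⟩
      suc (o + o + n) + suc (s + s + n) ≡⟨ cong (_+ suc (s + s + n)) (sym pq) ⟩
      p + q + suc (s + s + n)           ∎)
  where
  open ≡-Reasoning
  far : ∀ {x y y′} → x + y ≡ suc (o + o + n) → o < x → y + y′ ≡ suc (o + n + s) → s < y′
  far e o<x e′ = complement-< (o + n) s 0 (trans e′ (sym (cong suc (+-identityʳ _))))
    (complement-≤ (suc o) (o + n) (trans e (cong suc (+-assoc o o n))) o<x)

private
  mirror-edge : ∀ N ℓ n r P Q → N ≡ ℓ + n + r → Within ℓ P → Within r Q →
                ∀ {p q} → Edge N ℓ n P Q p q → Edge N r n Q P (suc N ∸ p) (suc N ∸ q)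
  mirror-edge N ℓ n r P Q refl P≤ Q≤ {p} {q} e with e
  ... | left a = right (opp (proj₁ (P≤ a))) (opp (proj₂ (P≤ a))) a
    where
    opp : ∀ {x} → x ≤ ℓ → Opposite N (suc N ∸ x) x
    opp x≤ℓ = m∸n+n≡m (m≤n⇒m≤1+n (≤-trans x≤ℓ (≤-trans (m≤m+n ℓ n) (m≤m+n (ℓ + n) r))))
  ... | right {p′} {q′} pp′ qq′ b
    rewrite opposite-unique N p p′ pp′ | opposite-unique N q q′ qq′ = left b
  ... | lower l@(0<p , 0<q , pq)
    rewrite opposite-unique N p q pq | opposite-unique N q p (trans (+-comm q p) pq) = lower (link-sym l)
  ... | middle l = middle (link-mirror ℓ n r (opp (proj₂ (proj₂ l)) (proj₁ (proj₂ l)))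
                                   (opp (proj₂ (proj₂ (link-sym l))) (proj₁ l)) l)
    where
    opp : ∀ {x y} → Opposite (ℓ + ℓ + n) x y → ℓ < y → Opposite N x (suc N ∸ x)
    opp {x} {y} eq ℓ<y = m+[n∸m]≡n (≤-trans
      (complement-≤ (suc ℓ) (ℓ + n) (trans (+-comm y x) (trans eq (cong suc (+-assoc ℓ ℓ n)))) ℓ<y)
      (m≤n⇒m≤1+n (m≤m+n (ℓ + n) r)))

-- Reduces a longer left side to a longer right side. `N` is a variable tied by an equation, because
-- reflection turns the sum ℓ + n + r into r + n + ℓ.
mirror : ∀ N ℓ n r P Q → N ≡ ℓ + n + r → Within ℓ P → Within r Q →
         Equivalence N (Edge N ℓ n P Q) N (Edge N r n Q P)
mirror N ℓ n r P Q eq P≤ Q≤ = record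
  { to         = suc N ∸_
  ; from       = suc N ∸_
  ; to-range   = range
  ; from-range = range
  ; to-edge    = Eq.return ∘ mirror-edge N ℓ n r P Q eq P≤ Q≤
  ; from-edge  = Eq.return ∘ mirror-edge N r n ℓ Q P (trans eq (swap ℓ n r)) Q≤ P≤
  ; from-to    = λ r → ≡⇒~ (m∸[m∸n]≡n (m≤n⇒m≤1+n (proj₂ r)))
  ; to-from    = λ r → ≡⇒~ (m∸[m∸n]≡n (m≤n⇒m≤1+n (proj₂ r)))
  }
  where
  swap : ∀ a b c → a + b + c ≡ c + b + a
  swap = solve-∀
  range : ∀ {p} → InRange N p → InRange N (suc N ∸ p)
  range {suc p} (_ , p≤N) = m<n⇒0<n∸m p≤N , m∸n≤m N p

-- Contraction of the chosen rainbow

-- `squeeze` pushes the δ points after `b` onto the next δ points and closes the gap that arises;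
-- `stretch` reopens the gap, so its values miss exactly those δ points.
squeeze stretch : ℕ → ℕ → ℕ → ℕ
squeeze b δ p with p ≤? b + δ
... | yes _ = p
... | no  _ = p ∸ δ
stretch b δ q with q ≤? b
... | yes _ = q
... | no  _ = q + δ

module _ {b δ : ℕ} where

  squeeze-low : ∀ {p} → p ≤ b + δ → squeeze b δ p ≡ p
  squeeze-low {p} p≤ with p ≤? b + δ
  ... | yes _ = refl
  ... | no p≰ = contradiction p≤ p≰

  squeeze-high : ∀ {p} → b < p → squeeze b δ (p + δ) ≡ p
  squeeze-high {p} b<p with p + δ ≤? b + δ
  ... | yes p≤ = contradiction (+-cancelʳ-≤ δ p b p≤) (<⇒≱ b<p)
  ... | no  _  = m+n∸n≡m p δ

  stretch-low : ∀ {q} → q ≤ b → stretch b δ q ≡ q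
  stretch-low {q} q≤ with q ≤? b
  ... | yes _ = refl
  ... | no q≰ = contradiction q≤ q≰

  stretch-high : ∀ {q} → b < q → stretch b δ q ≡ q + δ
  stretch-high {q} b<q with q ≤? b
  ... | yes q≤ = contradiction q≤ (<⇒≱ b<q)
  ... | no  _  = refl

-- In the second case the point appears as a sum, so that the truncated subtraction in `squeeze`
-- cancels.
data Position (b δ : ℕ) : ℕ → Set where
  before : ∀ {p} → p ≤ b + δ → Position b δ p
  beyond : ∀ {p} → b < p → Position b δ (p + δ)

locate : ∀ b δ p → Position b δ p
locate b δ p with p ≤? b + δ
... | yes p≤ = before p≤
... | no  p≰ = subst (Position b δ) eq
  (beyond (+-cancelʳ-< δ b (p ∸ δ) (subst (b + δ <_) (sym eq) (≰⇒> p≰))))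
  where
  eq : p ∸ δ + δ ≡ p
  eq = m∸n+n≡m (≤-trans (m≤n+m δ b) (<⇒≤ (≰⇒> p≰)))

squeeze-range : ∀ b δ N {p} → b + δ ≤ N → InRange (N + δ) p → InRange N (squeeze b δ p)
squeeze-range b δ N {p} b≤ (0<p , p≤) with locate b δ p
... | before p≤b rewrite squeeze-low {b} {δ} p≤b = 0<p , ≤-trans p≤b b≤
... | beyond {p₁} b<p rewrite squeeze-high {b} {δ} b<p = ≤-<-trans z≤n b<p , +-cancelʳ-≤ δ p₁ N p≤

stretch-range : ∀ b δ N {q} → InRange N q → InRange (N + δ) (stretch b δ q)
stretch-range b δ N {q} (0<q , q≤) with q ≤? b
... | yes q≤b = 0<q , ≤-trans q≤ (m≤m+n N δ)
... | no  q≰b = ≤-trans 0<q (m≤m+n q δ) , +-monoˡ-≤ δ q≤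

squeeze-stretch : ∀ b δ q → squeeze b δ (stretch b δ q) ≡ q
squeeze-stretch b δ q with q ≤? b
... | yes q≤b = squeeze-low {b} {δ} (≤-trans q≤b (m≤m+n b δ))
... | no  q≰b = squeeze-high {b} {δ} (≰⇒> q≰b)

-- The right side is longer by δ points, and the first δ points of the rainbow are contracted. This
-- exchanges the roles of two kinds of arcs: a lower arc with both ends beyond these points becomes
-- a middle arc, and a middle arc between two of them becomes a lower arc. The position of the ends
-- relative to ℓ + δ decides every case.
module Cut (ℓ n δ : ℕ) (P Q : Rel ℕ 0ℓ) (P≤ : Within ℓ P) (Q≤ : Within (ℓ + δ) Q) where

  N′ : ℕ
  N′ = ℓ + n + (ℓ + δ)

  Old New : Rel ℕ 0ℓ
  Old = Edge (N′ + δ) ℓ (n + δ) P Q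
  New = Edge N′ ℓ n P Q

  f g : ℕ → ℕ
  f = squeeze ℓ δ
  g = stretch ℓ δ

  old : ∀ {p q} → Old p q → EqClosure Old p q
  old = Eq.return

  new : ∀ {p q} → New p q → EqClosure New p q
  new = Eq.return

  pos : ∀ {x} → ℓ < x → 0 < x
  pos = ≤-<-trans z≤n

  -- x goes by the middle rainbow and then by the lower one to x + δ
  drift : ∀ {x y} → Link ℓ (n + δ) x y → EqClosure Old x (x + δ)
  drift {x} {y} l@(ℓ<x , ℓ<y , xy) = old (middle l) ◅◅
    old (lower (pos ℓ<y , ≤-trans (pos ℓ<x) (m≤m+n x δ) , (begin
      y + (x + δ)                     ≡⟨ solve (x ∷ y ∷ δ ∷ []) ⟩
      x + y + δ                       ≡⟨ cong (_+ δ) xy ⟩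
      suc (ℓ + ℓ + (n + δ)) + δ       ≡⟨ solve (ℓ ∷ n ∷ δ ∷ []) ⟩
      suc (ℓ + n + (ℓ + δ) + δ)       ∎)))
    where open ≡-Reasoning

  -- Serves right and lower arcs alike. In both, p′ is the reflection of p; if it is at most ℓ + δ,
  -- then p lies beyond the contracted points and moves down by δ together with the right end of the
  -- axis.
  far : ∀ {p p′} → Opposite (N′ + δ) p p′ → p′ ≤ ℓ + δ → ℓ < f p × Opposite N′ (f p) p′
  far {p} {p′} eq p′≤ with locate ℓ δ p
  ... | before p≤ = contradiction p′≤ (<⇒≱ (complement-< (ℓ + δ) (ℓ + δ) n
    (trans eq (cong suc (solve (ℓ ∷ n ∷ δ ∷ [])))) p≤))
  ... | beyond {p₁} ℓ<p₁ rewrite squeeze-high {ℓ} {δ} ℓ<p₁ = ℓ<p₁ , +-cancelʳ-≡ δ _ _ (begin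
    p₁ + p′ + δ   ≡⟨ solve (p₁ ∷ p′ ∷ δ ∷ []) ⟩
    p₁ + δ + p′   ≡⟨ eq ⟩
    suc N′ + δ    ∎)
    where open ≡-Reasoning

  to-edge : ∀ {p q} → Old p q → EqClosure New (f p) (f q)
  to-edge (left a)
    rewrite squeeze-low {ℓ} {δ} (≤-trans (proj₁ (P≤ a)) (m≤m+n ℓ δ))
          | squeeze-low {ℓ} {δ} (≤-trans (proj₂ (P≤ a)) (m≤m+n ℓ δ)) = new (left a)
  to-edge (right pp′ qq′ b) =
    new (right (proj₂ (far pp′ (proj₁ (Q≤ b)))) (proj₂ (far qq′ (proj₂ (Q≤ b)))) b)
  to-edge {p} {q} (lower (0<p , 0<q , pq)) with locate ℓ δ p | locate ℓ δ q
  ... | before p≤ | _ rewrite squeeze-low {ℓ} {δ} p≤ =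
    let ℓ<fq , fq = far (trans (+-comm q p) pq) p≤ in
    new (lower (0<p , pos ℓ<fq , trans (+-comm p _) fq))
  ... | beyond _ | before q≤ rewrite squeeze-low {ℓ} {δ} q≤ =
    let ℓ<fp , fp = far pq q≤ in new (lower (pos ℓ<fp , 0<q , fp))
  ... | beyond {p₁} ℓ<p₁ | beyond {q₁} ℓ<q₁
    rewrite squeeze-high {ℓ} {δ} ℓ<p₁ | squeeze-high {ℓ} {δ} ℓ<q₁ =
    new (middle (ℓ<p₁ , ℓ<q₁ , +-cancelʳ-≡ (δ + δ) _ _ (begin
      p₁ + q₁ + (δ + δ)         ≡⟨ solve (p₁ ∷ q₁ ∷ δ ∷ []) ⟩
      p₁ + δ + (q₁ + δ)         ≡⟨ pq ⟩
      suc (ℓ + n + (ℓ + δ) + δ) ≡⟨ solve (ℓ ∷ n ∷ δ ∷ []) ⟩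
      suc (ℓ + ℓ + n) + (δ + δ) ∎)))
    where open ≡-Reasoning
  to-edge {p} {q} (middle (ℓ<p , ℓ<q , pq)) with locate ℓ δ p | locate ℓ δ q
  ... | before p≤ | before q≤
    rewrite squeeze-low {ℓ} {δ} p≤ | squeeze-low {ℓ} {δ} q≤ =
    new (lower (pos ℓ<p , pos ℓ<q , trans pq (cong suc (solve (ℓ ∷ n ∷ δ ∷ [])))))
  ... | before p≤ | beyond {q₁} ℓ<q₁
    rewrite squeeze-low {ℓ} {δ} p≤ | squeeze-high {ℓ} {δ} ℓ<q₁ =
    new (middle (ℓ<p , ℓ<q₁ , +-cancelʳ-≡ δ _ _ (begin
      p + q₁ + δ            ≡⟨ +-assoc p q₁ δ ⟩
      p + (q₁ + δ)          ≡⟨ pq ⟩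
      suc (ℓ + ℓ + (n + δ)) ≡⟨ solve (ℓ ∷ n ∷ δ ∷ []) ⟩
      suc (ℓ + ℓ + n) + δ   ∎)))
    where open ≡-Reasoning
  ... | beyond {p₁} ℓ<p₁ | before q≤
    rewrite squeeze-high {ℓ} {δ} ℓ<p₁ | squeeze-low {ℓ} {δ} q≤ =
    new (middle (ℓ<p₁ , ℓ<q , +-cancelʳ-≡ δ _ _ (begin
      p₁ + q + δ            ≡⟨ solve (p₁ ∷ q ∷ δ ∷ []) ⟩
      p₁ + δ + q            ≡⟨ pq ⟩
      suc (ℓ + ℓ + (n + δ)) ≡⟨ solve (ℓ ∷ n ∷ δ ∷ []) ⟩
      suc (ℓ + ℓ + n) + δ   ∎)))
    where open ≡-Reasoning
  ... | beyond {p₁} ℓ<p₁ | beyond {q₁} ℓ<q₁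
    rewrite squeeze-high {ℓ} {δ} ℓ<p₁ | squeeze-high {ℓ} {δ} ℓ<q₁ =
    -- The ends have moved to p₁ = p - δ and q₁ = q - δ, whose sum is too small for a single arc.
    -- The path p₁, q, p, q₁ joins them, with the old ends p and q as intermediate points of the new
    -- graph.
    new (middle (ℓ<p₁ , ℓ<q , p₁+q)) ◅◅
    new (lower (pos ℓ<q , pos ℓ<p , (begin
      q₁ + δ + (p₁ + δ)     ≡⟨ +-comm (q₁ + δ) (p₁ + δ) ⟩
      p₁ + δ + (q₁ + δ)     ≡⟨ pq ⟩
      suc (ℓ + ℓ + (n + δ)) ≡⟨ solve (ℓ ∷ n ∷ δ ∷ []) ⟩
      suc (ℓ + n + (ℓ + δ)) ∎))) ◅◅
    new (middle (ℓ<p , ℓ<q₁ , q₁+p))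
    where
    open ≡-Reasoning
    p₁+q : p₁ + (q₁ + δ) ≡ suc (ℓ + ℓ + n)
    p₁+q = +-cancelʳ-≡ δ _ _ (begin
      p₁ + (q₁ + δ) + δ     ≡⟨ solve (p₁ ∷ q₁ ∷ δ ∷ []) ⟩
      p₁ + δ + (q₁ + δ)     ≡⟨ pq ⟩
      suc (ℓ + ℓ + (n + δ)) ≡⟨ solve (ℓ ∷ n ∷ δ ∷ []) ⟩
      suc (ℓ + ℓ + n) + δ   ∎)
    q₁+p : p₁ + δ + q₁ ≡ suc (ℓ + ℓ + n)
    q₁+p = begin
      p₁ + δ + q₁     ≡⟨ solve (p₁ ∷ q₁ ∷ δ ∷ []) ⟩
      p₁ + (q₁ + δ)   ≡⟨ p₁+q ⟩
      suc (ℓ + ℓ + n) ∎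

  stretched : ∀ {p p′} → Opposite N′ p p′ → p′ ≤ ℓ + δ → Opposite (N′ + δ) (g p) p′
  stretched {p} {p′} eq p′≤ = begin
    g p + p′     ≡⟨ cong (_+ p′) (stretch-high {ℓ} {δ} (complement-< (ℓ + δ) ℓ n
                      (trans (+-comm p′ p) (trans eq (cong suc (solve (ℓ ∷ n ∷ δ ∷ []))))) p′≤)) ⟩
    p + δ + p′   ≡⟨ solve (p ∷ p′ ∷ δ ∷ []) ⟩
    p + p′ + δ   ≡⟨ cong (_+ δ) eq ⟩
    suc N′ + δ   ∎
    where open ≡-Reasoning

  from-edge : ∀ {p q} → New p q → EqClosure Old (g p) (g q)
  from-edge (left a)
    rewrite stretch-low {ℓ} {δ} (proj₁ (P≤ a)) | stretch-low {ℓ} {δ} (proj₂ (P≤ a)) =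
    old (left a)
  from-edge (right pp′ qq′ b) =
    old (right (stretched pp′ (proj₁ (Q≤ b))) (stretched qq′ (proj₂ (Q≤ b))) b)
  from-edge {p} {q} (middle (ℓ<p , ℓ<q , pq))
    rewrite stretch-high {ℓ} {δ} ℓ<p | stretch-high {ℓ} {δ} ℓ<q =
    old (lower (≤-trans (pos ℓ<p) (m≤m+n p δ) , ≤-trans (pos ℓ<q) (m≤m+n q δ) , (begin
      p + δ + (q + δ)           ≡⟨ solve (p ∷ q ∷ δ ∷ []) ⟩
      p + q + (δ + δ)           ≡⟨ cong (_+ (δ + δ)) pq ⟩
      suc (ℓ + ℓ + n) + (δ + δ) ≡⟨ solve (ℓ ∷ n ∷ δ ∷ []) ⟩
      suc (ℓ + n + (ℓ + δ) + δ) ∎)))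
    where open ≡-Reasoning
  from-edge {p} {q} (lower (0<p , 0<q , pq)) with p ≤? ℓ
  ... | yes p≤ = old (lower (0<p , proj₁ (stretch-range ℓ δ q (0<q , ≤-refl)) , trans (+-comm p _)
        (stretched (trans (+-comm q p) pq) (≤-trans p≤ (m≤m+n ℓ δ)))))
  ... | no  p≰ with q ≤? ℓ
  ...   | yes q≤ = old (lower (≤-trans 0<p (m≤m+n p δ) , 0<q ,
    subst (λ x → Opposite (N′ + δ) x q) (stretch-high {ℓ} {δ} (≰⇒> p≰))
      (stretched pq (≤-trans q≤ (m≤m+n ℓ δ)))))
  ...   | no  q≰ =
    -- Before stretching, p and q are the ends of an old middle arc; `drift` carries each of them to
    -- its stretched position.
    Eq.symmetric Old (drift l) ◅◅ old (middle l) ◅◅ drift (link-sym {ℓ} {n + δ} l)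
    where
    l : Link ℓ (n + δ) p q
    l = ≰⇒> p≰ , ≰⇒> q≰ , trans pq (cong suc (solve (ℓ ∷ n ∷ δ ∷ [])))

  from-to : ∀ {p} → EqClosure Old (g (f p)) p
  from-to {p} with locate ℓ δ p
  ... | beyond {p₁} ℓ<p₁ rewrite squeeze-high {ℓ} {δ} ℓ<p₁ = ≡⇒~ (stretch-high {ℓ} {δ} ℓ<p₁)
  ... | before p≤ rewrite squeeze-low {ℓ} {δ} p≤ with p ≤? ℓ
  ...   | yes _  = ε
  -- Only the contracted points are moved by the round trip: p comes back as p + δ, and `drift`
  -- connects the two by way of the partner of p in the rainbow.
  ...   | no  p≰ = Eq.symmetric Old (drift {y = suc x ∸ p} (ℓ<p , ℓ<y , p+y))
    where
    x : ℕ
    x = ℓ + ℓ + (n + δ)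
    ℓ<p : ℓ < p
    ℓ<p = ≰⇒> p≰
    p+y : p + (suc x ∸ p) ≡ suc x
    p+y = m+[n∸m]≡n (m≤n⇒m≤1+n (≤-trans p≤ (+-mono-≤ (m≤m+n ℓ ℓ) (m≤n+m δ n))))
    ℓ<y : ℓ < suc x ∸ p
    ℓ<y = complement-< (ℓ + δ) ℓ n (trans p+y (cong suc (solve (ℓ ∷ n ∷ δ ∷ [])))) p≤

  equivalence : Equivalence (N′ + δ) Old N′ New
  equivalence = record
    { to         = f
    ; from       = g
    ; to-range   = squeeze-range ℓ δ N′ (m≤n+m (ℓ + δ) (ℓ + n))
    ; from-range = stretch-range ℓ δ N′
    ; to-edge    = to-edge
    ; from-edge  = from-edge
    ; from-to    = λ _ → from-to
    ; to-from    = λ {q} _ → ≡⇒~ (squeeze-stretch ℓ δ q)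
    }

-- Removal of the innermost arc of a balanced rainbow

-- Here `b` is the midpoint of the rainbow and also of the whole axis. The innermost arc of the
-- rainbow and the innermost lower arc therefore share their ends b + 1 and b + 2 and close up.
-- Since the number of classes changes, the labelling is built by hand, with the fresh label `k` for
-- this curve.
module Innermost (ℓ a b : ℕ) (b≡ℓ+a : b ≡ ℓ + a) (P Q : Rel ℕ 0ℓ)
                 (P≤ : Within ℓ P) (Q≤ : Within ℓ Q) where

  Old New : Rel ℕ 0ℓ
  Old = Edge (b + b + 2) ℓ (a + a + 2) P Q
  New = Edge (b + b) ℓ (a + a) P Q

  g : ℕ → ℕ
  g = stretch b 2

  ℓ≤b : ℓ ≤ b
  ℓ≤b = subst (ℓ ≤_) (sym b≡ℓ+a) (m≤m+n ℓ a)

  Core : ℕ → Set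
  Core p = b < p × p ≤ b + 2

  data Site : ℕ → Set where
    core  : ∀ {p} → Core p → Site p
    outer : ∀ p → Site (g p)

  site : ∀ p → Site p
  site p with locate b 2 p
  ... | beyond {p₁} b<p = subst Site (stretch-high {b} {2} b<p) (outer p₁)
  ... | before p≤ with p ≤? b
  ...   | yes p≤b = subst Site (stretch-low {b} {2} p≤b) (outer p)
  ...   | no  p≰b = core (≰⇒> p≰b , p≤)

  core-opposite : ∀ {p q} → Opposite (b + b + 2) p q → Core p → Core q
  core-opposite {p} {q} eq (b<p , p≤) =
      complement-< (b + 2) b 0 (trans eq (cong suc (solve (b ∷ [])))) p≤
    , complement-≤ (suc b) (b + 2) (trans eq (cong suc (+-assoc b b 2))) b<p

  stretch-opposite : ∀ {p q} → Opposite (b + b) p q → Opposite (b + b + 2) (g p) (g q)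
  stretch-opposite {p} {q} eq with p ≤? b | q ≤? b
  ... | yes p≤ | yes q≤ = contradiction (+-mono-≤ p≤ q≤) (<⇒≱ (≤-reflexive (sym eq)))
  ... | yes p≤ | no  q≰ = trans (sym (+-assoc p q 2)) (cong (_+ 2) eq)
  ... | no  p≰ | yes q≤ = begin
    p + 2 + q       ≡⟨ solve (p ∷ q ∷ []) ⟩
    p + q + 2       ≡⟨ cong (_+ 2) eq ⟩
    suc (b + b) + 2 ∎
    where open ≡-Reasoning
  ... | no  p≰ | no  q≰ = contradiction (+-mono-≤ (≰⇒> p≰) (≰⇒> q≰))
    (<⇒≱ (≤-reflexive (cong suc (trans eq (sym (+-suc b b))))))

  unstretch-opposite : ∀ {p q} → Opposite (b + b + 2) (g p) (g q) → Opposite (b + b) p q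
  unstretch-opposite {p} {q} eq with p ≤? b | q ≤? b
  ... | yes p≤ | yes q≤ = contradiction (+-mono-≤ p≤ q≤)
    (<⇒≱ (≤-trans (s≤s (m≤m+n (b + b) 2)) (≤-reflexive (sym eq))))
  ... | yes p≤ | no  q≰ = +-cancelʳ-≡ 2 _ _ (trans (+-assoc p q 2) eq)
  ... | no  p≰ | yes q≤ = +-cancelʳ-≡ 2 _ _ (begin
    p + q + 2       ≡⟨ solve (p ∷ q ∷ []) ⟩
    p + 2 + q       ≡⟨ eq ⟩
    suc (b + b) + 2 ∎)
    where open ≡-Reasoning
  ... | no  p≰ | no  q≰ = contradiction eq (>⇒≢ (begin-strict
    suc (b + b + 2)     <⟨ m<m+n (suc (b + b + 2)) {3} z<s ⟩
    suc (b + b + 2) + 3 ≡⟨ solve (b ∷ []) ⟩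
    suc b + 2 + (suc b + 2) ≤⟨ +-mono-≤ (+-monoˡ-≤ 2 (≰⇒> p≰)) (+-monoˡ-≤ 2 (≰⇒> q≰)) ⟩
    p + 2 + (q + 2) ∎))
    where open ≤-Reasoning

  g-positive : ∀ {p} → 0 < g p → 0 < p
  g-positive {p} 0<g with p ≤? b
  ... | yes _   = 0<g
  ... | no  p≰b = ≤-<-trans z≤n (≰⇒> p≰b)

  g-range : ∀ {p} → InRange (b + b + 2) (g p) → InRange (b + b) p
  g-range {p} (0<g , g≤) with p ≤? b
  ... | yes p≤b = 0<g , ≤-trans p≤b (m≤m+n b b)
  ... | no  p≰b = ≤-<-trans z≤n (≰⇒> p≰b) , +-cancelʳ-≤ 2 p (b + b) g≤

  far : ∀ {p p′} → p′ ≤ ℓ → Opposite (b + b) p p′ → Opposite (b + b + 2) (g p) p′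
  far {p} {p′} p′≤ eq = subst (Opposite (b + b + 2) (g p)) (stretch-low {b} {2} (≤-trans p′≤ ℓ≤b))
    (stretch-opposite {p} {p′} eq)

  pos : ∀ {x} → ℓ < x → 0 < x
  pos = ≤-<-trans z≤n

  nest : ∀ {p q} → Link 0 (b + b) p q → Old (g p) (g q)
  nest {p} {q} (0<p , 0<q , eq) =
    lower (≤-trans 0<p (g-≥ p) , ≤-trans 0<q (g-≥ q) , stretch-opposite {p} {q} eq)
    where
    g-≥ : ∀ p → p ≤ g p
    g-≥ p with p ≤? b
    ... | yes _ = ≤-refl
    ... | no  _ = m≤m+n p 2

  g-edge : ∀ {p q} → New p q → Old (g p) (g q)
  g-edge (left e)
    rewrite stretch-low {b} {2} (≤-trans (proj₁ (P≤ e)) ℓ≤b)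
          | stretch-low {b} {2} (≤-trans (proj₂ (P≤ e)) ℓ≤b) = left e
  g-edge (right pp′ qq′ e) = right (far (proj₁ (Q≤ e)) pp′) (far (proj₂ (Q≤ e)) qq′) e
  g-edge (lower l) = nest l
  -- By balance the arc has the same ends as a lower arc, so its image can be taken to be a lower
  -- one.
  g-edge {p} {q} (middle (ℓ<p , ℓ<q , eq)) = nest (pos ℓ<p , pos ℓ<q , (begin
    p + q                 ≡⟨ eq ⟩
    suc (ℓ + ℓ + (a + a)) ≡⟨ cong suc (solve (ℓ ∷ a ∷ [])) ⟩
    suc (ℓ + a + (ℓ + a)) ≡⟨ cong (λ x → suc (x + x)) (sym b≡ℓ+a) ⟩
    suc (b + b)           ∎))
    where open ≡-Reasoning

  module _ {k} (A : Labelling (b + b) New k) where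

    open Labelling A using ()
      renaming ( label to label′; bounded to bounded′; sound to sound′
               ; complete to complete′; onto to onto′ )

    label : ℕ → ℕ
    label p with p ≤? b | p ≤? b + 2
    ... | yes _ | _     = label′ p
    ... | no  _ | yes _ = k
    ... | no  _ | no  _ = label′ (p ∸ 2)

    label-core : ∀ {p} → Core p → label p ≡ k
    label-core {p} (b<p , p≤) with p ≤? b | p ≤? b + 2
    ... | yes p≤b | _      = contradiction p≤b (<⇒≱ b<p)
    ... | no  _   | yes _  = refl
    ... | no  _   | no  p≰ = contradiction p≤ p≰

    label-outer : ∀ p → label (g p) ≡ label′ p
    label-outer p with p ≤? b
    ... | yes p≤b with p ≤? b
    ...   | yes _  = refl
    ...   | no p≰b = contradiction p≤b p≰b
    label-outer p | no p≰b with p + 2 ≤? b | p + 2 ≤? b + 2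
    ... | yes p+2≤b | _         = contradiction (≤-trans (m≤m+n p 2) p+2≤b) p≰b
    ... | no  _     | yes p+2≤ = contradiction (+-cancelʳ-≤ 2 p b p+2≤) p≰b
    ... | no  _     | no  _     = cong label′ (m+n∸n≡m p 2)

    outer-bounded : ∀ p → InRange (b + b + 2) (g p) → label (g p) < k
    outer-bounded p r = subst (_< k) (sym (label-outer p)) (bounded′ (g-range r))

    bounded : ∀ {p} → InRange (b + b + 2) p → label p < suc k
    bounded {p} r with site p
    ... | core c   = s≤s (≤-reflexive (label-core c))
    ... | outer p′ = m<n⇒m<1+n (outer-bounded p′ r)

    across : ∀ {p q} → Link 0 (b + b + 2) p q → label p ≡ label q
    across {p} {q} l@(0<p , 0<q , eq) with site p | site q
    ... | core c  | _       = trans (label-core c) (sym (label-core (core-opposite eq c)))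
    ... | _       | core c  =
      trans (label-core (core-opposite (trans (+-comm q p) eq) c)) (sym (label-core c))
    ... | outer x | outer y = trans (label-outer x) (trans
      (sound′ (lower (g-positive 0<p , g-positive 0<q , unstretch-opposite {x} {y} eq)))
      (sym (label-outer y)))

    -- Balance makes reflection in the rainbow the reflection of the whole axis, so that `across`
    -- settles the middle arcs as well.
    widen : ∀ {p q} → Link ℓ (a + a + 2) p q → Link 0 (b + b + 2) p q
    widen {p} {q} (ℓ<p , ℓ<q , eq) = pos ℓ<p , pos ℓ<q , (begin
      p + q                     ≡⟨ eq ⟩
      suc (ℓ + ℓ + (a + a + 2)) ≡⟨ cong suc (solve (ℓ ∷ a ∷ [])) ⟩
      suc (ℓ + a + (ℓ + a) + 2) ≡⟨ cong (λ x → suc (x + x + 2)) (sym b≡ℓ+a) ⟩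
      suc (b + b + 2)           ∎)
      where open ≡-Reasoning

    label-left : ∀ {p} → p ≤ ℓ → label p ≡ label′ p
    label-left {p} p≤ = trans (cong label (sym (stretch-low {b} {2} (≤-trans p≤ ℓ≤b)))) (label-outer p)

    label-right : ∀ {p p′} → p′ ≤ ℓ → Opposite (b + b + 2) p p′ →
                  ∃[ x ] label p ≡ label′ x × Opposite (b + b) x p′
    label-right {p} {p′} p′≤ eq with site p
    ... | core c  = contradiction (≤-trans p′≤ ℓ≤b) (<⇒≱ (proj₁ (core-opposite eq c)))
    ... | outer x = x , label-outer x , unstretch-opposite {x} {p′} (trans
      (cong (g x +_) (stretch-low {b} {2} (≤-trans p′≤ ℓ≤b))) eq)

    sound : ∀ {p q} → Old p q → label p ≡ label q
    sound (left e) = trans (label-left (proj₁ (P≤ e)))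
      (trans (sound′ (left e)) (sym (label-left (proj₂ (P≤ e)))))
    sound (middle l) = across (widen l)
    sound (lower l) = across l
    sound (right pp′ qq′ e) with label-right (proj₁ (Q≤ e)) pp′ | label-right (proj₂ (Q≤ e)) qq′
    ... | x , p≡x , xp′ | y , q≡y , yq′ = trans p≡x (trans (sound′ (right xp′ yq′ e)) (sym q≡y))

    innermost : Old (b + 1) (b + 2)
    innermost = lower (m≤n+m 1 b , <-≤-trans z<s (m≤n+m 2 b) , solve (b ∷ []))

    core-connected : ∀ {p q} → Core p → Core q → EqClosure Old p q
    core-connected c d with core-points c | core-points d
      where
      core-points : ∀ {p} → Core p → p ≡ b + 1 ⊎ p ≡ b + 2
      core-points {p} (b<p , p≤) with m≤n⇒m<n∨m≡n p≤
      ... | inj₂ p≡    = inj₂ p≡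
      ... | inj₁ p<b+2 = inj₁ (≤-antisym
        (s≤s⁻¹ (subst (p <_) (+-suc b 1) p<b+2)) (subst (_≤ p) (+-comm 1 b) b<p))
    ... | inj₁ refl | inj₁ refl = ε
    ... | inj₂ refl | inj₂ refl = ε
    ... | inj₁ refl | inj₂ refl = Eq.return innermost
    ... | inj₂ refl | inj₁ refl = Eq.symmetric Old (Eq.return innermost)

    complete : ∀ {p q} → InRange (b + b + 2) p → InRange (b + b + 2) q →
               label p ≡ label q → EqClosure Old p q
    complete {p} {q} p∈ q∈ eq with site p | site q
    ... | core c  | core d  = core-connected c d
    ... | core c  | outer y = contradiction (trans (sym eq) (label-core c)) (<⇒≢ (outer-bounded y q∈))
    ... | outer x | core d  = contradiction (trans eq (label-core d)) (<⇒≢ (outer-bounded x p∈))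
    ... | outer x | outer y = Eq.gmap g g-edge (complete′ (g-range p∈) (g-range q∈)
      (trans (sym (label-outer x)) (trans eq (label-outer y))))

    onto : ∀ {i} → i < suc k → ∃[ p ] InRange (b + b + 2) p × label p ≡ i
    onto {i} (s≤s i≤k) with m≤n⇒m<n∨m≡n i≤k
    ... | inj₁ i<k  = let (q , q∈ , q≡i) = onto′ i<k in
      g q , stretch-range b 2 (b + b) q∈ , trans (label-outer q) q≡i
    ... | inj₂ refl = suc b , (z<s , ≤-trans (≤-reflexive (+-comm 1 b)) (+-mono-≤ (m≤m+n b b) (s≤s z≤n)))
      , label-core (≤-refl , ≤-trans (≤-reflexive (+-comm 1 b)) (+-monoʳ-≤ b (s≤s z≤n)))

    labelling : Labelling (b + b + 2) Old (suc k)
    labelling = record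
      { label = label ; bounded = bounded ; sound = sound ; complete = complete ; onto = onto }

-- Lists of rainbows

open import Data.Fin.Base using (zero; suc)
open import Data.List.Relation.Unary.All using ([]; _∷_)

-- A running offset replaces the index and the prefix sum of `UpperArc`; splitting the list then
-- splits the arcs.
Upper : ℕ → List ℕ → Rel ℕ 0ℓ
Upper o []       p q = ⊥
Upper o (x ∷ xs) p q = Link o (2 * x) p q ⊎ Upper (o + 2 * x) xs p q

-- As Upper, but with end points counted from the right: p stands for 2∑α + 1 − p.
UpperFromRight : List ℕ → Rel ℕ 0ℓ
UpperFromRight []       p q = ⊥
UpperFromRight (x ∷ xs) p q = Link (2 * sum xs) (2 * x) p q ⊎ UpperFromRight xs p q

data Curve (αs : List ℕ) (p q : ℕ) : Set where
  above : Upper 0 αs p q → Curve αs p q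
  below : Link 0 (2 * sum αs) p q → Curve αs p q

link-upper : ∀ {o n p q} → Link o n p q → p ≤ o + n
link-upper {o} {n} {p} {q} (_ , o<q , eq) =
  complement-≤ (suc o) (o + n) (trans (+-comm q p) (trans eq (cong suc (+-assoc o o n)))) o<q

link-within : ∀ {o n b p q} → o + n ≤ b → Link o n p q → p ≤ b × q ≤ b
link-within {o} {n} {b} {p} {q} le l =
    ≤-trans (link-upper {o} {n} {p} {q} l) le
  , ≤-trans (link-upper {o} {n} {q} {p} (link-sym {o} {n} {p} {q} l)) le

upper-within : ∀ o αs → Within (o + 2 * sum αs) (Upper o αs)
upper-within o (x ∷ xs) {p} {q} (inj₁ l) =
  link-within {o} {2 * x} {_} {p} {q} (+-monoʳ-≤ o (*-monoʳ-≤ 2 (m≤m+n x (sum xs)))) l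
upper-within o (x ∷ xs) {p} {q} (inj₂ u) =
  subst (λ b → p ≤ b × q ≤ b) (trans (+-assoc o _ _) (cong (o +_) (sym (*-distribˡ-+ 2 x (sum xs)))))
    (upper-within (o + 2 * x) xs u)

right-within : ∀ αs → Within (2 * sum αs) (UpperFromRight αs)
right-within (x ∷ xs) {p} {q} (inj₁ l) = link-within {2 * sum xs} {2 * x} {_} {p} {q}
  (≤-reflexive (trans (+-comm (2 * sum xs) (2 * x)) (sym (*-distribˡ-+ 2 x (sum xs))))) l
right-within (x ∷ xs) {p} {q} (inj₂ u) = let p≤ , q≤ = right-within xs u in ≤-trans p≤ le , ≤-trans q≤ le
  where
  le : 2 * sum xs ≤ 2 * (x + sum xs)
  le = *-monoʳ-≤ 2 (m≤n+m (sum xs) x)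

upper-positive : ∀ o αs {p q} → Upper o αs p q → 0 < p × 0 < q
upper-positive o (x ∷ xs) (inj₁ (o<p , o<q , _)) = ≤-<-trans z≤n o<p , ≤-<-trans z≤n o<q
upper-positive o (x ∷ xs) (inj₂ u) = upper-positive (o + 2 * x) xs u

upper-++⁺ : ∀ o xs ys {p q} → Upper o xs p q ⊎ Upper (o + 2 * sum xs) ys p q → Upper o (xs ++ ys) p q
upper-++⁺ o []       ys {p} {q} (inj₂ u) = subst (λ o → Upper o ys p q) (+-identityʳ o) u
upper-++⁺ o (x ∷ xs) ys (inj₁ (inj₁ l)) = inj₁ l
upper-++⁺ o (x ∷ xs) ys (inj₁ (inj₂ u)) = inj₂ (upper-++⁺ (o + 2 * x) xs ys (inj₁ u))
upper-++⁺ o (x ∷ xs) ys {p} {q} (inj₂ u) = inj₂ (upper-++⁺ (o + 2 * x) xs ys (inj₂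
  (subst (λ o → Upper o ys p q)
    (trans (cong (o +_) (*-distribˡ-+ 2 x (sum xs))) (sym (+-assoc o _ _))) u)))

upper-++⁻ : ∀ o xs ys {p q} → Upper o (xs ++ ys) p q → Upper o xs p q ⊎ Upper (o + 2 * sum xs) ys p q
upper-++⁻ o []       ys {p} {q} u = inj₂ (subst (λ o → Upper o ys p q) (sym (+-identityʳ o)) u)
upper-++⁻ o (x ∷ xs) ys (inj₁ l) = inj₁ (inj₁ l)
upper-++⁻ o (x ∷ xs) ys {p} {q} (inj₂ u) with upper-++⁻ (o + 2 * x) xs ys u
... | inj₁ v = inj₁ (inj₂ v)
... | inj₂ v = inj₂ (subst (λ o → Upper o ys p q)
  (trans (+-assoc o _ _) (cong (o +_) (sym (*-distribˡ-+ 2 x (sum xs))))) v)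

private
  offsets : ∀ o x s → o + 2 * (x + s) ≡ o + 2 * x + 2 * s
  offsets = solve-∀

-- The right end `o + 2 * sum αs` stays fixed while the recursion passes a family, so the same
-- reflection serves at every level.
fromRight⁺ : ∀ o αs {p q p′ q′} → Opposite (o + 2 * sum αs) p p′ → Opposite (o + 2 * sum αs) q q′ →
             Upper o αs p q → UpperFromRight αs p′ q′
fromRight⁺ o (x ∷ xs) {p} {q} {p′} {q′} pp′ qq′ (inj₁ l) = inj₁ (link-mirror o (2 * x) (2 * sum xs)
  {p} {q} {p′} {q′}
  (trans pp′ (cong suc (offsets o x (sum xs)))) (trans qq′ (cong suc (offsets o x (sum xs)))) l)
fromRight⁺ o (x ∷ xs) {p} {q} {p′} {q′} pp′ qq′ (inj₂ u) = inj₂ (fromRight⁺ (o + 2 * x) xs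
  {p} {q} {p′} {q′}
  (trans pp′ (cong suc (offsets o x (sum xs)))) (trans qq′ (cong suc (offsets o x (sum xs)))) u)

fromRight⁻ : ∀ o αs {p q p′ q′} → Opposite (o + 2 * sum αs) p p′ → Opposite (o + 2 * sum αs) q q′ →
             UpperFromRight αs p′ q′ → Upper o αs p q
fromRight⁻ o (x ∷ xs) {p} {q} {p′} {q′} pp′ qq′ (inj₁ l) = inj₁ (link-mirror (2 * sum xs) (2 * x) o
  {p′} {q′} {p} {q} (flipped p p′ pp′) (flipped q q′ qq′) l)
  where
  flipped : ∀ y y′ → Opposite (o + 2 * (x + sum xs)) y y′ → Opposite (2 * sum xs + 2 * x + o) y′ y
  flipped y y′ eq = trans (+-comm y′ y) (trans eq (cong suc (rearrange o x (sum xs))))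
    where
    rearrange : ∀ o x s → o + 2 * (x + s) ≡ 2 * s + 2 * x + o
    rearrange = solve-∀
fromRight⁻ o (x ∷ xs) {p} {q} {p′} {q′} pp′ qq′ (inj₂ u) = inj₂ (fromRight⁻ (o + 2 * x) xs
  {p} {q} {p′} {q′}
  (trans pp′ (cong suc (offsets o x (sum xs)))) (trans qq′ (cong suc (offsets o x (sum xs)))) u)

-- Puts one family of a list in the place of the middle rainbow of `Edge`, where contraction and
-- removal apply.
module Focus (ls : List ℕ) (a : ℕ) (rs : List ℕ) where

  αs : List ℕ
  αs = ls ++ a ∷ rs

  L R N : ℕ
  L = sum ls
  R = sum rs
  N = 2 * L + 2 * a + 2 * R

  size : 2 * sum αs ≡ N
  size = trans (cong (2 *_) (sum-++ ls (a ∷ rs))) (expand L a R)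
    where
    expand : ∀ l a r → 2 * (l + (a + r)) ≡ 2 * l + 2 * a + 2 * r
    expand = solve-∀

  E : Rel ℕ 0ℓ
  E = Edge N (2 * L) (2 * a) (Upper 0 ls) (UpperFromRight rs)

  E⁻ : ∀ {p q} → E p q → Curve αs p q
  E⁻ (left u)   = above (upper-++⁺ 0 ls (a ∷ rs) (inj₁ u))
  E⁻ (middle l) = above (upper-++⁺ 0 ls (a ∷ rs) (inj₂ (inj₁ l)))
  E⁻ {p} {q} (right {p′} {q′} pp′ qq′ u) =
    above (upper-++⁺ 0 ls (a ∷ rs) (inj₂ (inj₂
      (fromRight⁻ (2 * L + 2 * a) rs {p} {q} {p′} {q′} pp′ qq′ u))))
  E⁻ {p} {q} (lower l) = below (subst (λ M → Link 0 M p q) (sym size) l)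

  E⁺ : ∀ {p q} → Curve αs p q → E p q
  E⁺ {p} {q} (below l) = lower (subst (λ M → Link 0 M p q) size l)
  E⁺ {p} {q} (above u) with upper-++⁻ 0 ls (a ∷ rs) u
  ... | inj₁ v        = left v
  ... | inj₂ (inj₁ l) = middle l
  ... | inj₂ (inj₂ v) = right {p′ = suc N ∸ p} {q′ = suc N ∸ q} p+ q+
    (fromRight⁺ (2 * L + 2 * a) rs {p} {q} p+ q+ v)
    where
    p+ : Opposite N p (suc N ∸ p)
    p+ = m+[n∸m]≡n (m≤n⇒m≤1+n (proj₁ (upper-within (2 * L + 2 * a) rs v)))
    q+ : Opposite N q (suc N ∸ q)
    q+ = m+[n∸m]≡n (m≤n⇒m≤1+n (proj₂ (upper-within (2 * L + 2 * a) rs v)))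

-- Agreement of `Curve` with the arcs that define `𝒵`

UpperEnds : (αs : List ℕ) → Fin (length αs) → ℕ → ℕ → Set
UpperEnds αs ℓ i j = 0 < i × 0 < j × i + j ≡ suc (2 * lookup αs ℓ)

private
  interchange : ∀ o i j → o + o + (i + j) ≡ o + i + (o + j)
  interchange = solve-∀

  offset-suc : ∀ o x xs ℓ i → o + 2 * x + (offset xs ℓ + i) ≡ o + (offset (x ∷ xs) (suc ℓ) + i)
  offset-suc o x xs ℓ = reassociate o x (sum (take (toℕ ℓ) xs))
    where
    reassociate : ∀ o x s i → o + 2 * x + (2 * s + i) ≡ o + (2 * (x + s) + i)
    reassociate = solve-∀

ends⇒upper : ∀ o αs ℓ {i j} → UpperEnds αs ℓ i j →
             Upper o αs (o + (offset αs ℓ + i)) (o + (offset αs ℓ + j))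
ends⇒upper o (x ∷ xs) zero {i} {j} (0<i , 0<j , eq) = inj₁ (m<m+n o 0<i , m<m+n o 0<j , (begin
  o + i + (o + j)   ≡⟨ sym (interchange o i j) ⟩
  o + o + (i + j)   ≡⟨ cong (o + o +_) eq ⟩
  o + o + suc (2 * x) ≡⟨ +-suc (o + o) (2 * x) ⟩
  suc (o + o + 2 * x) ∎))
  where open ≡-Reasoning
ends⇒upper o (x ∷ xs) (suc ℓ) {i} {j} ends =
  inj₂ (subst₂ (Upper (o + 2 * x) xs) (offset-suc o x xs ℓ i) (offset-suc o x xs ℓ j)
    (ends⇒upper (o + 2 * x) xs ℓ ends))

upper⇒ends : ∀ o αs {p q} → Upper o αs p q → ∃[ ℓ ] ∃[ i ] ∃[ j ] UpperEnds αs ℓ i j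
             × p ≡ o + (offset αs ℓ + i) × q ≡ o + (offset αs ℓ + j)
upper⇒ends o (x ∷ xs) {p} {q} (inj₁ (o<p , o<q , eq)) =
  zero , p ∸ o , q ∸ o
  , (m<n⇒0<n∸m o<p , m<n⇒0<n∸m o<q , +-cancelˡ-≡ (o + o) _ _ (begin
      o + o + (p ∸ o + (q ∸ o))   ≡⟨ interchange o (p ∸ o) (q ∸ o) ⟩
      o + (p ∸ o) + (o + (q ∸ o)) ≡⟨ cong₂ _+_ (m+[n∸m]≡n (<⇒≤ o<p)) (m+[n∸m]≡n (<⇒≤ o<q)) ⟩
      p + q                       ≡⟨ eq ⟩
      suc (o + o + 2 * x)         ≡⟨ sym (+-suc (o + o) (2 * x)) ⟩
      o + o + suc (2 * x)         ∎))
  , sym (m+[n∸m]≡n (<⇒≤ o<p)) , sym (m+[n∸m]≡n (<⇒≤ o<q))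
  where open ≡-Reasoning
upper⇒ends o (x ∷ xs) (inj₂ u) with upper⇒ends (o + 2 * x) xs u
... | ℓ , i , j , ends , p≡ , q≡ =
  suc ℓ , i , j , ends , trans p≡ (offset-suc o x xs ℓ i) , trans q≡ (offset-suc o x xs ℓ j)

private
  smaller-end : ∀ v {i j} → i + j ≡ suc (2 * v) → i ≤ v ⊎ j ≤ v
  smaller-end v {i} {j} eq with i ≤? v
  ... | yes i≤v = inj₁ i≤v
  ... | no  i≰v = inj₂ (complement-≤ (suc v) v (trans eq (cong suc (cong (v +_) (+-identityʳ v))))
    (≰⇒> i≰v))

  other-end : ∀ o v {i j} → i + j ≡ suc (2 * v) → o + j ≡ o + 2 * v + 1 ∸ i
  other-end o v {i} {j} eq = sym (begin
    o + 2 * v + 1 ∸ i   ≡⟨ cong (_∸ i) (+-assoc o (2 * v) 1) ⟩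
    o + (2 * v + 1) ∸ i ≡⟨ cong (λ w → o + w ∸ i)
                             (trans (+-comm (2 * v) 1) (trans (sym eq) (+-comm i j))) ⟩
    o + (j + i) ∸ i     ≡⟨ cong (_∸ i) (sym (+-assoc o j i)) ⟩
    o + j + i ∸ i       ≡⟨ m+n∸n≡m (o + j) i ⟩
    o + j               ∎)
    where open ≡-Reasoning

  opposite-end : ∀ v {i} → 0 < i → i ≤ v → ∃[ j ] 0 < j × i + j ≡ suc (2 * v)
  opposite-end v {i} 0<i i≤v = suc (2 * v) ∸ i , m<n⇒0<n∸m (s≤s i≤2v) , m+[n∸m]≡n (m≤n⇒m≤1+n i≤2v)
    where
    i≤2v : i ≤ 2 * v
    i≤2v = ≤-trans i≤v (m≤m+n v _)

arc⇒curve : ∀ αs {p q} → UpperArc αs p q ⊎ LowerArc αs p q → Curve αs p q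
arc⇒curve αs (inj₁ (ℓ , i , 0<i , i≤v , refl , refl)) with opposite-end (lookup αs ℓ) 0<i i≤v
... | j , 0<j , eq = above (subst (Upper 0 αs (offset αs ℓ + i))
  (other-end (offset αs ℓ) (lookup αs ℓ) eq)
  (ends⇒upper 0 αs ℓ (0<i , 0<j , eq)))
arc⇒curve αs (inj₂ (k , 0<k , k≤α , refl , refl)) with opposite-end (sum αs) 0<k k≤α
... | j , 0<j , eq = below (subst (Link 0 (2 * sum αs) k) (other-end 0 (sum αs) eq) (0<k , 0<j , eq))

upperArc-ends : ∀ αs ℓ {i j} → UpperEnds αs ℓ i j → i ≤ lookup αs ℓ →
                UpperArc αs (offset αs ℓ + i) (offset αs ℓ + j)
upperArc-ends αs ℓ {i} (0<i , _ , eq) i≤v =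
  ℓ , i , 0<i , i≤v , refl , other-end (offset αs ℓ) (lookup αs ℓ) eq

-- `Curve` contains every arc in both directions, `Arc` only from the left end to the right one.
-- Hence the second alternative, which the generated equivalence absorbs.
curve⇒arc : ∀ αs {p q} → Curve αs p q →
            (UpperArc αs p q ⊎ LowerArc αs p q) ⊎ (UpperArc αs q p ⊎ LowerArc αs q p)
curve⇒arc αs (above u) with upper⇒ends 0 αs u
... | ℓ , i , j , ends@(0<i , 0<j , eq) , refl , refl with smaller-end (lookup αs ℓ) eq
...   | inj₁ i≤v = inj₁ (inj₁ (upperArc-ends αs ℓ ends i≤v))
...   | inj₂ j≤v = inj₂ (inj₁ (upperArc-ends αs ℓ (0<j , 0<i , trans (+-comm j i) eq) j≤v))
curve⇒arc αs {p} {q} (below (0<p , 0<q , eq)) with smaller-end (sum αs) eq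
... | inj₁ p≤ = inj₁ (inj₂ (p , 0<p , p≤ , refl , other-end 0 (sum αs) eq))
... | inj₂ q≤ = inj₂ (inj₂ (q , 0<q , q≤ , refl , other-end 0 (sum αs) (trans (+-comm q p) eq)))

curve-range : ∀ αs {p q} → Curve αs p q → InRange (2 * sum αs) p × InRange (2 * sum αs) q
curve-range αs (above u) with upper-positive 0 αs u | upper-within 0 αs u
... | 0<p , 0<q | p≤ , q≤ = (0<p , p≤) , (0<q , q≤)
curve-range αs {p} {q} (below l@(0<p , 0<q , _)) with link-within {0} {2 * sum αs} {_} {p} {q} ≤-refl l
... | p≤ , q≤ = (0<p , p≤) , (0<q , q≤)

data Point (N : ℕ) : ℕ → Set where
  point : (x : Fin N) → Point N (position x)

inRange⇒point : ∀ {N p} → InRange N p → Point N p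
inRange⇒point {N} {suc p} (_ , p<N) =
  subst (λ y → Point N (suc y)) (Fin.toℕ-fromℕ< p<N) (point (fromℕ< p<N))

point-range : ∀ {N} (x : Fin N) → InRange N (position x)
point-range x = z<s , Fin.toℕ<n x

componentLabelling : ∀ αs → Labelling (2 * sum αs) (Curve αs) (𝒵 αs)
componentLabelling αs = record
  { label    = label
  ; bounded  = bounded
  ; sound    = sound
  ; complete = complete
  ; onto     = onto
  }
  where
  N : ℕ
  N = 2 * sum αs
  B : HasComponents (Arc αs) (𝒵 αs)
  B = proj₂ (components (Arc αs) (arc? αs))

  label : ℕ → ℕ
  -- The values at 0 and beyond `N` are arbitrary: by `curve-range` no arc ends there.
  label p with pred p <? N
  ... | yes p<N = toℕ (Bijection.to B (fromℕ< p<N))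
  ... | no  _   = 0

  label-point : ∀ x → label (position x) ≡ toℕ (Bijection.to B x)
  label-point x with toℕ x <? N
  ... | yes x<N = cong (toℕ ∘ Bijection.to B) (Fin.fromℕ<-toℕ x x<N)
  ... | no  x≮N = contradiction (Fin.toℕ<n x) x≮N

  bounded : ∀ {p} → InRange N p → label p < 𝒵 αs
  bounded p∈ with inRange⇒point p∈
  ... | point x = subst (_< 𝒵 αs) (sym (label-point x)) (Fin.toℕ<n (Bijection.to B x))

  arc-sound : ∀ {x y} → Arc αs x y → label (position x) ≡ label (position y)
  arc-sound {x} {y} e = trans (label-point x)
    (trans (cong toℕ (Bijection.cong B (Eq.return e))) (sym (label-point y)))

  sound : ∀ {p q} → Curve αs p q → label p ≡ label q
  sound e with curve-range αs e
  ... | p∈ , q∈ with inRange⇒point p∈ | inRange⇒point q∈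
  ...   | point x | point y with curve⇒arc αs e
  ...     | inj₁ a = arc-sound a
  ...     | inj₂ a = sym (arc-sound a)

  complete : ∀ {p q} → InRange N p → InRange N q → label p ≡ label q → EqClosure (Curve αs) p q
  complete p∈ q∈ eq with inRange⇒point p∈ | inRange⇒point q∈
  ... | point x | point y = Eq.gmap position (arc⇒curve αs) (Bijection.injective B
    (Fin.toℕ-injective (trans (sym (label-point x)) (trans eq (label-point y)))))

  onto : ∀ {i} → i < 𝒵 αs → ∃[ p ] InRange N p × label p ≡ i
  onto i<k with Bijection.surjective B (fromℕ< i<k)
  ... | x , to-x = position x , point-range x
    , trans (label-point x) (trans (cong toℕ (to-x ε)) (Fin.toℕ-fromℕ< i<k))

𝒵-unique : ∀ αs {k} → Labelling (2 * sum αs) (Curve αs) k → 𝒵 αs ≡ k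
𝒵-unique αs = labelling-unique (componentLabelling αs)

-- Recursion formulas for 𝒵

cut-right : ∀ {N N′ ℓ n n′ r} δ {P Q k} → r ≡ ℓ + δ → n′ ≡ n + δ → N ≡ ℓ + n′ + r → N′ ≡ ℓ + n + r →
            Within ℓ P → Within r Q →
            Labelling N′ (Edge N′ ℓ n P Q) k → Labelling N (Edge N ℓ n′ P Q) k
cut-right {ℓ = ℓ} {n} δ {P} {Q} {k} refl refl refl refl P≤ Q≤ A =
  subst (λ N → Labelling N (Edge N ℓ (n + δ) P Q) k) (resize ℓ n δ)
    (relabel (Cut.equivalence ℓ n δ P Q P≤ Q≤) A)
  where
  resize : ∀ ℓ n δ → ℓ + n + (ℓ + δ) + δ ≡ ℓ + (n + δ) + (ℓ + δ)
  resize = solve-∀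

private
  reverse-sum : ∀ a b c → a + b + c ≡ c + b + a
  reverse-sum = solve-∀

-- Conjugates `cut-right` by the reflection.
cut-left : ∀ {N N′ ℓ n n′ r} δ {P Q k} → ℓ ≡ r + δ → n′ ≡ n + δ → N ≡ ℓ + n′ + r → N′ ≡ ℓ + n + r →
           Within ℓ P → Within r Q →
           Labelling N′ (Edge N′ ℓ n P Q) k → Labelling N (Edge N ℓ n′ P Q) k
cut-left {N} {N′} {ℓ} {n} {n′} {r} δ {P} {Q} ℓ≡ n′≡ N≡ N′≡ P≤ Q≤ A =
  relabel (mirror N ℓ n′ r P Q N≡ P≤ Q≤)
    (cut-right δ ℓ≡ n′≡ (trans N≡ (reverse-sum ℓ n′ r)) N′≡ᵐ Q≤ P≤
      (relabel (mirror N′ r n ℓ Q P N′≡ᵐ Q≤ P≤) A))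
  where
  N′≡ᵐ : N′ ≡ r + n + ℓ
  N′≡ᵐ = trans N′≡ (reverse-sum ℓ n r)

module _ (ls : List ℕ) (rs : List ℕ) where

  private
    L R : ℕ
    L = sum ls
    R = sum rs

    Count : ℕ → ℕ → Set
    Count a k = Labelling N E k
      where open Focus ls a rs

    counted : ∀ a → Count a (𝒵 (ls ++ a ∷ rs))
    counted a = relabel (sameEdges E⁻ E⁺)
      (subst (λ M → Labelling M (Curve αs) (𝒵 αs)) size (componentLabelling αs))
      where open Focus ls a rs

    count-unique : ∀ a {k} → Count a k → 𝒵 (ls ++ a ∷ rs) ≡ k
    count-unique a {k} A = 𝒵-unique αs
      (subst (λ M → Labelling M (Curve αs) k) (sym size) (relabel (sameEdges E⁺ E⁻) A))
      where open Focus ls a rs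

    ls-within : Within (2 * L) (Upper 0 ls)
    ls-within = upper-within 0 ls

    rs-within : Within (2 * R) (UpperFromRight rs)
    rs-within = right-within rs

  -- The longer side exceeds the other by d arcs, that is by `2 * d` end points, and this is the δ
  -- of the contraction.
  𝒵-cut : ∀ a → 𝒵 (ls ++ (a + ∣ L - R ∣) ∷ rs) ≡ 𝒵 (ls ++ a ∷ rs)
  𝒵-cut a = count-unique (a + d) cut
    where
    d : ℕ
    d = ∣ L - R ∣
    cut : Count (a + d) (𝒵 (ls ++ a ∷ rs))
    cut with ≤-total L R
    ... | inj₁ L≤R = cut-right (2 * d) R≡ (*-distribˡ-+ 2 a d) refl refl ls-within rs-within (counted a)
      where
      R≡ : 2 * R ≡ 2 * L + 2 * d
      R≡ = trans (cong (2 *_) (sym (trans (cong (L +_) (m≤n⇒∣m-n∣≡n∸m L≤R)) (m+[n∸m]≡n L≤R))))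
        (*-distribˡ-+ 2 L d)
    ... | inj₂ R≤L = cut-left (2 * d) L≡ (*-distribˡ-+ 2 a d) refl refl ls-within rs-within (counted a)
      where
      L≡ : 2 * L ≡ 2 * R + 2 * d
      L≡ = trans (cong (2 *_) (sym (trans (cong (R +_) (m≤n⇒∣n-m∣≡n∸m R≤L)) (m+[n∸m]≡n R≤L))))
        (*-distribˡ-+ 2 R d)

  𝒵-cuts : ∀ a j → 𝒵 (ls ++ (a + j * ∣ L - R ∣) ∷ rs) ≡ 𝒵 (ls ++ a ∷ rs)
  𝒵-cuts a zero    = cong (λ b → 𝒵 (ls ++ b ∷ rs)) (+-identityʳ a)
  𝒵-cuts a (suc j) = begin
    𝒵 (ls ++ (a + (d + j * d)) ∷ rs) ≡⟨ cong (λ b → 𝒵 (ls ++ b ∷ rs)) (move a d (j * d)) ⟩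
    𝒵 (ls ++ (a + j * d + d) ∷ rs)   ≡⟨ 𝒵-cut (a + j * d) ⟩
    𝒵 (ls ++ (a + j * d) ∷ rs)       ≡⟨ 𝒵-cuts a j ⟩
    𝒵 (ls ++ a ∷ rs)                 ∎
    where
    open ≡-Reasoning
    d : ℕ
    d = ∣ L - R ∣
    move : ∀ a d e → a + (d + e) ≡ a + e + d
    move = solve-∀

  𝒵-innermost : L ≡ R → ∀ a → 𝒵 (ls ++ suc a ∷ rs) ≡ suc (𝒵 (ls ++ a ∷ rs))
  𝒵-innermost L≡R a = count-unique (suc a)
    (subst₂ (λ M n → Labelling M (Edge M ℓ n (Upper 0 ls) (UpperFromRight rs)) (suc (𝒵 (ls ++ a ∷ rs))))
      new-size (twice-suc a)
      (Innermost.labelling ℓ a (ℓ + a) refl _ _ ls-within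
        (subst (λ b → Within b (UpperFromRight rs)) (cong (2 *_) (sym L≡R)) rs-within)
        (subst₂ (λ M n → Labelling M (Edge M ℓ n (Upper 0 ls) (UpperFromRight rs)) (𝒵 (ls ++ a ∷ rs)))
          old-size (twice a) (counted a))))
    where
    ℓ : ℕ
    ℓ = 2 * L
    twice : ∀ a → 2 * a ≡ a + a
    twice = solve-∀
    twice-suc : ∀ a → a + a + 2 ≡ 2 * suc a
    twice-suc = solve-∀
    new-size′ : ∀ ℓ a → ℓ + a + (ℓ + a) + 2 ≡ ℓ + 2 * suc a + ℓ
    new-size′ = solve-∀
    new-size : ℓ + a + (ℓ + a) + 2 ≡ ℓ + 2 * suc a + 2 * R
    new-size = trans (new-size′ ℓ a) (cong (λ x → ℓ + 2 * suc a + 2 * x) L≡R)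
    old-size′ : ∀ ℓ a → ℓ + 2 * a + ℓ ≡ ℓ + a + (ℓ + a)
    old-size′ = solve-∀
    old-size : ℓ + 2 * a + 2 * R ≡ ℓ + a + (ℓ + a)
    old-size = trans (cong (λ x → ℓ + 2 * a + 2 * x) (sym L≡R)) (old-size′ ℓ a)

  -- Turns a remainder 0 into the removal of the family, and starts the induction in `𝒵-balanced`.
  𝒵-empty : 𝒵 (ls ++ 0 ∷ rs) ≡ 𝒵 (ls ++ rs)
  𝒵-empty = 𝒵-unique (ls ++ 0 ∷ rs) (relabel (sameEdges remove insert)
    (subst (λ s → Labelling (2 * s) (Curve (ls ++ rs)) (𝒵 (ls ++ rs))) (sym same-sum)
      (componentLabelling (ls ++ rs))))
    where
    same-sum : sum (ls ++ 0 ∷ rs) ≡ sum (ls ++ rs)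
    same-sum = trans (sum-++ ls (0 ∷ rs)) (sym (sum-++ ls rs))
    remove : ∀ {p q} → Curve (ls ++ 0 ∷ rs) p q → Curve (ls ++ rs) p q
    remove {p} {q} (below l) = below (subst (λ s → Link 0 (2 * s) p q) same-sum l)
    remove {p} {q} (above u) with upper-++⁻ 0 ls (0 ∷ rs) u
    ... | inj₁ v = above (upper-++⁺ 0 ls rs (inj₁ v))
    ... | inj₂ (inj₂ v) = above (upper-++⁺ 0 ls rs (inj₂
      (subst (λ o → Upper o rs p q) (+-identityʳ (2 * L)) v)))
    ... | inj₂ (inj₁ l@(o<p , _ , _)) =
      contradiction (link-upper {2 * L} {0} {p} {q} l)
        (<⇒≱ (subst (_< p) (sym (+-identityʳ (2 * L))) o<p))
    insert : ∀ {p q} → Curve (ls ++ rs) p q → Curve (ls ++ 0 ∷ rs) p q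
    insert {p} {q} (below l) = below (subst (λ s → Link 0 (2 * s) p q) (sym same-sum) l)
    insert {p} {q} (above u) with upper-++⁻ 0 ls rs u
    ... | inj₁ v = above (upper-++⁺ 0 ls (0 ∷ rs) (inj₁ v))
    ... | inj₂ v = above (upper-++⁺ 0 ls (0 ∷ rs) (inj₂ (inj₂
      (subst (λ o → Upper o rs p q) (sym (+-identityʳ (2 * L))) v))))

  𝒵-balanced : L ≡ R → ∀ a → 𝒵 (ls ++ a ∷ rs) ≡ 𝒵 (ls ++ rs) + a
  𝒵-balanced L≡R zero    = trans 𝒵-empty (sym (+-identityʳ _))
  𝒵-balanced L≡R (suc a) = trans (𝒵-innermost L≡R a)
    (trans (cong suc (𝒵-balanced L≡R a)) (sym (+-suc _ a)))

  𝒵-remainder : ∀ a .{{_ : NonZero ∣ L - R ∣}} → 𝒵 (ls ++ a ∷ rs) ≡ 𝒵 (ls ++ (a % ∣ L - R ∣) ∷ rs)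
  𝒵-remainder a = trans (cong (λ b → 𝒵 (ls ++ b ∷ rs)) (m≡m%n+[m/n]*n a ∣ L - R ∣))
    (𝒵-cuts (a % ∣ L - R ∣) (a / ∣ L - R ∣))

  𝒵-divisible : ∀ a .{{_ : NonZero ∣ L - R ∣}} → a % ∣ L - R ∣ ≡ 0 → 𝒵 (ls ++ a ∷ rs) ≡ 𝒵 (ls ++ rs)
  𝒵-divisible a r≡0 = trans (𝒵-remainder a) (trans (cong (λ b → 𝒵 (ls ++ b ∷ rs)) r≡0) 𝒵-empty)

-- One step of the recursion

module _ {A : Set} where

  split-at : ∀ (xs : List A) m → take (toℕ m) xs ++ lookup xs m ∷ drop (suc (toℕ m)) xs ≡ xs
  split-at (x ∷ xs) zero    = refl
  split-at (x ∷ xs) (suc m) = cong (x ∷_) (split-at xs m)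

  removeAt-split : ∀ (xs : List A) m → removeAt xs m ≡ take (toℕ m) xs ++ drop (suc (toℕ m)) xs
  removeAt-split (x ∷ xs)         zero    = refl
  removeAt-split (x ∷ xs@(_ ∷ _)) (suc m) = cong (x ∷_) (removeAt-split xs m)

  update-split : ∀ (xs : List A) m v → xs [ m ]∷= v ≡ take (toℕ m) xs ++ v ∷ drop (suc (toℕ m)) xs
  update-split (x ∷ xs) zero    v = refl
  update-split (x ∷ xs) (suc m) v = cong (x ∷_) (update-split xs m v)

sum-take-suc : ∀ xs m → sum (take (suc (toℕ m)) xs) ≡ sum (take (toℕ m) xs) + lookup xs m
sum-take-suc (x ∷ xs) zero    = +-identityʳ x
sum-take-suc (x ∷ xs) (suc m) = trans (cong (x +_) (sum-take-suc xs m)) (sym (+-assoc x _ _))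

sum-split : ∀ xs m → sum xs ≡ leftOf xs m + lookup xs m + rightOf xs m
sum-split xs m = begin
  sum xs                                                ≡⟨ cong sum (sym (split-at xs m)) ⟩
  sum (take (toℕ m) xs ++ lookup xs m ∷ drop (suc (toℕ m)) xs) ≡⟨ sum-++ (take (toℕ m) xs) _ ⟩
  leftOf xs m + (lookup xs m + rightOf xs m)            ≡⟨ sym (+-assoc (leftOf xs m) _ _) ⟩
  leftOf xs m + lookup xs m + rightOf xs m              ∎
  where open ≡-Reasoning

-- The cases of `reduce` for a list already split at the chosen family. Divisibility is stated as a
-- vanishing remainder, which is what the program tests, so the value, the run and the decrease can
-- all be proved by matching on the same three cases.
data Reduction (ls : List ℕ) (a : ℕ) (rs : List ℕ) : List ℕ × ℕ → Set where
  balanced  : sum ls ≡ sum rs → Reduction ls a rs (ls ++ rs , a)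
  divisible : .{{_ : NonZero ∣ sum ls - sum rs ∣}} → sum ls ≢ sum rs →
              a % ∣ sum ls - sum rs ∣ ≡ 0 → Reduction ls a rs (ls ++ rs , 0)
  remainder : .{{_ : NonZero ∣ sum ls - sum rs ∣}} → sum ls ≢ sum rs →
              a % ∣ sum ls - sum rs ∣ ≢ 0 →
              Reduction ls a rs (ls ++ (a % ∣ sum ls - sum rs ∣) ∷ rs , 0)

reduction : ∀ αs m → Reduction (take (toℕ m) αs) (lookup αs m) (drop (suc (toℕ m)) αs) (reduce αs m)
reduction αs m with leftOf αs m ≟ rightOf αs m
... | yes L≡R rewrite removeAt-split αs m = balanced L≡R
... | no  L≢R with ∣ leftOf αs m - rightOf αs m ∣ ∣? lookup αs m
...   | yes d∣a rewrite removeAt-split αs m =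
  divisible {{≢-nonZero (L≢R ∘ ∣m-n∣≡0⇒m≡n)}} L≢R
    (n∣m⇒m%n≡0 _ _ {{≢-nonZero (L≢R ∘ ∣m-n∣≡0⇒m≡n)}} d∣a)
...   | no  d∤a
  rewrite update-split αs m
    (_%_ (lookup αs m) ∣ leftOf αs m - rightOf αs m ∣ {{≢-nonZero (L≢R ∘ ∣m-n∣≡0⇒m≡n)}}) =
  remainder {{≢-nonZero (L≢R ∘ ∣m-n∣≡0⇒m≡n)}} L≢R
    (d∤a ∘ m%n≡0⇒n∣m _ _ {{≢-nonZero (L≢R ∘ ∣m-n∣≡0⇒m≡n)}})

𝒵-reduction : ∀ {ls a rs βs d} → Reduction ls a rs (βs , d) → 𝒵 (ls ++ a ∷ rs) ≡ 𝒵 βs + d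
𝒵-reduction {ls} {a} {rs} (balanced L≡R)    = 𝒵-balanced ls rs L≡R a
𝒵-reduction {ls} {a} {rs} (divisible _ r≡0) = trans (𝒵-divisible ls rs a r≡0) (sym (+-identityʳ _))
𝒵-reduction {ls} {a} {rs} (remainder _ _)   = trans (𝒵-remainder ls rs a) (sym (+-identityʳ _))

𝒵-reduce : ∀ αs m → let (βs , d) = reduce αs m in 𝒵 αs ≡ 𝒵 βs + d
𝒵-reduce αs m = trans (cong 𝒵 (sym (split-at αs m))) (𝒵-reduction (reduction αs m))

-- Evaluation of programs

-- An upper bound in place of the exact cost lets branches of different length share one estimate.
Runs : ∀ {A} → Program ℕ A → A → ℕ → Set
Runs p a n = ∃[ c ] p ⇓ a ⟨ c ⟩ × c ≤ n

module _ {A : Set} where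

  runs-weaken : ∀ {p : Program ℕ A} {a m n} → m ≤ n → Runs p a m → Runs p a n
  runs-weaken m≤n (c , p⇓ , c≤m) = c , p⇓ , ≤-trans c≤m m≤n

  runs-return : ∀ {a : A} {n} → Runs (return a) a n
  runs-return = 0 , return , z≤n

  runs-less : ∀ {x y b k} {a : A} {n} → (x <ᵇ y) ≡ b → Runs (k b) a n → Runs (less x y k) a (suc n)
  runs-less refl (c , r , c≤n) = suc c , less r , s≤s c≤n

  runs-equal : ∀ {x y b k} {a : A} {n} → (x ≡ᵇ y) ≡ b → Runs (k b) a n → Runs (equal x y k) a (suc n)
  runs-equal refl (c , r , c≤n) = suc c , equal r , s≤s c≤n

  runs-plus : ∀ {x y k} {a : A} {n} → Runs (k (x + y)) a n → Runs (plus x y k) a (suc n)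
  runs-plus (c , r , c≤n) = suc c , plus r , s≤s c≤n

  -- The equation provides both the inequality that keeps the subtraction from getting stuck and the
  -- value of the difference.
  runs-minus : ∀ {x y z k} {a : A} {n} → x ≡ y + z → Runs (k z) a n → Runs (minus x y k) a (suc n)
  runs-minus {y = y} {z} {k} refl (c , r , c≤n) =
    suc c , minus (m≤m+n y z) (subst (λ w → k w ⇓ _ ⟨ c ⟩) (sym (m+n∸m≡n y z)) r) , s≤s c≤n

  runs-divide : ∀ {x y k} {a : A} {n} .{{_ : NonZero y}} →
                Runs (k (x / y , x % y)) a n → Runs (divide x y k) a (suc n)
  runs-divide (c , r , c≤n) = suc c , divide r , s≤s c≤n

⇓->>= : ∀ {A B} {p : Program ℕ A} {f : A → Program ℕ B} {a b c d} →
        p ⇓ a ⟨ c ⟩ → f a ⇓ b ⟨ d ⟩ → (p >>= f) ⇓ b ⟨ c + d ⟩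
⇓->>= return         s = s
⇓->>= (less r)       s = less (⇓->>= r s)
⇓->>= (equal r)      s = equal (⇓->>= r s)
⇓->>= (plus r)       s = plus (⇓->>= r s)
⇓->>= (minus y≤x r)  s = minus y≤x (⇓->>= r s)
⇓->>= (divide r)     s = divide (⇓->>= r s)

runs->>= : ∀ {A B} {p : Program ℕ A} {f : A → Program ℕ B} {a b m n} →
           Runs p a m → Runs (f a) b n → Runs (p >>= f) b (m + n)
runs->>= (c , r , c≤m) (d , s , d≤n) = c + d , ⇓->>= r s , +-mono-≤ c≤m d≤n

open Algorithm 0 using (total; distance; findMiddle)

total-runs : ∀ xs → Runs (total xs) (sum xs) (length xs)
total-runs []       = runs-return
total-runs (x ∷ xs) = runs-weaken (≤-reflexive (+-comm (length xs) 1))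
  (runs->>= (total-runs xs) (runs-plus runs-return))

distance-runs : ∀ x y → Runs (distance x y) ∣ x - y ∣ 2
distance-runs x y with x <? y
-- The Boolean part of `x <? y` computes to `x <ᵇ y`, on which the program branches.
... | yes x<y = runs-less (dec-true (x <? y) x<y) (runs-minus
  (sym (trans (cong (x +_) (m≤n⇒∣m-n∣≡n∸m (<⇒≤ x<y))) (m+[n∸m]≡n (<⇒≤ x<y)))) runs-return)
... | no  x≮y = runs-less (dec-false (x <? y) x≮y) (runs-minus
  (sym (trans (cong (y +_) (m≤n⇒∣n-m∣≡n∸m (≮⇒≥ x≮y))) (m+[n∸m]≡n (≮⇒≥ x≮y)))) runs-return)

private
  doubling : ∀ n → n + n ≡ 2 * n
  doubling = solve-∀

-- A test takes two additions and one comparison, and the last family is accepted untested: hence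
-- three operations for each family after the first. The bounds on `m` say that every earlier test
-- succeeds and that the one at `m`, if made, fails.
findMiddle-runs : ∀ α L x xs m →
  2 * (L + leftOf (x ∷ xs) m) < α → α ≤ 2 * (L + sum (take (suc (toℕ m)) (x ∷ xs))) →
  Runs (findMiddle α L x xs)
       (take (toℕ m) (x ∷ xs) , L + leftOf (x ∷ xs) m , lookup (x ∷ xs) m , drop (suc (toℕ m)) (x ∷ xs))
       (3 * length xs)
findMiddle-runs α L x [] zero lo hi rewrite +-identityʳ L = runs-return
findMiddle-runs α L x (y ∷ ys) zero lo hi rewrite +-identityʳ L | +-identityʳ x =
  runs-weaken (≤-trans (m≤m+n 3 (3 * length ys)) (≤-reflexive (sym (*-suc 3 (length ys)))))
    (runs-plus (runs-plus (runs-less (dec-false (L + x + (L + x) <? α)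
      (≤⇒≯ (subst (α ≤_) (sym (doubling (L + x))) hi))) runs-return)))
findMiddle-runs α L x (y ∷ ys) (suc m) lo hi
  rewrite sym (+-assoc L x (leftOf (y ∷ ys) m)) | sym (+-assoc L x (sum (take (suc (toℕ m)) (y ∷ ys)))) =
  runs-weaken (≤-reflexive (trans (cong (3 +_) (+-identityʳ _)) (sym (*-suc 3 (length ys)))))
    (runs-plus (runs-plus (runs-less (dec-true (L + x + (L + x) <? α) test)
      (runs->>= (findMiddle-runs α (L + x) y ys m lo hi) runs-return))))
  where
  test : L + x + (L + x) < α
  test = ≤-<-trans (≤-trans (≤-reflexive (doubling (L + x))) (*-monoʳ-≤ 2 (m≤m+n (L + x) _))) lo

step-runs : ∀ αs m z {βs d} → IsMiddle αs m →
            Reduction (take (toℕ m) αs) (lookup αs m) (drop (suc (toℕ m)) αs) (βs , d) →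
            Runs (step (αs , z)) (inj₂ (βs , z + d)) (8 * length αs)
step-runs αs@(x ∷ xs) m z (lo , hi) = λ
  { (balanced L≡R) → runs-weaken cost
      (runs->>= (total-runs αs) (runs->>= find (runs-plus (runs-minus (sum-split αs m)
        (runs-equal (dec-true (L ≟ R) L≡R) (runs-weaken (s≤s z≤n) (runs-plus {n = 0} runs-return)))))))
  ; (divisible L≢R r≡0) → unchanged
      (runs-weaken cost
        (runs->>= (total-runs αs) (runs->>= find (runs-plus (runs-minus (sum-split αs m)
          (runs-equal (dec-false (L ≟ R) L≢R) (runs->>= (distance-runs L R) (runs-divide
            (runs-equal (dec-true (_ ≟ 0) r≡0) runs-return)))))))))
  ; (remainder L≢R r≢0) → unchanged
      (runs-weaken cost
        (runs->>= (total-runs αs) (runs->>= find (runs-plus (runs-minus (sum-split αs m)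
          (runs-equal (dec-false (L ≟ R) L≢R) (runs->>= (distance-runs L R) (runs-divide
            (runs-equal (dec-false (_ ≟ 0) r≢0) runs-return)))))))))
  }
  where
  L R : ℕ
  L = leftOf αs m
  R = rightOf αs m
  find = findMiddle-runs (sum αs) 0 x xs m lo hi
  unchanged : ∀ {βs} → Runs (step (αs , z)) (inj₂ (βs , z)) (8 * length αs) →
              Runs (step (αs , z)) (inj₂ (βs , z + 0)) (8 * length αs)
  unchanged {βs} = subst (λ w → Runs (step (αs , z)) (inj₂ (βs , w)) _) (sym (+-identityʳ z))
  passes : ∀ n → suc n + (3 * n + 7) ≡ 8 + 4 * n
  passes = solve-∀
  -- At most seven operations follow the search: an addition, a subtraction, the balance test, two
  -- for the distance, the division and the zero test. For n families this makes 4n + 4, at most 8n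
  -- because n is positive.
  cost : length αs + (3 * length xs + 7) ≤ 8 * length αs
  cost = ≤-trans (≤-reflexive (passes (length xs)))
    (≤-trans (+-monoʳ-≤ 8 (*-monoˡ-≤ (length xs) {4} {8} (s≤s (s≤s (s≤s (s≤s z≤n))))))
      (≤-reflexive (sym (*-suc 8 (length xs)))))

-- Number of passes

bits-positive : ∀ a .{{_ : NonZero a}} → 0 < ⌈log₂ suc a ⌉
bits-positive a = ⌈log₂⌉-mono-≤ {2} (s≤s (>-nonZero⁻¹ a))

-- From 2r < a follows 2(r + 1) ≤ a + 1, and doubling raises the logarithm by exactly one.
bits-halve : ∀ r {a} → r + r < a → ⌈log₂ suc r ⌉ < ⌈log₂ suc a ⌉
bits-halve r 2r<a = ≤-trans (≤-reflexive (sym (⌈log₂2*n⌉≡1+⌈log₂n⌉ (suc r))))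
  (⌈log₂⌉-mono-≤ (≤-trans (≤-reflexive (twice-suc r)) (s≤s 2r<a)))
  where
  twice-suc : ∀ r → 2 * suc r ≡ suc (suc (r + r))
  twice-suc = solve-∀

-- The quotient is at least 1 because d ≤ a, so a is at least d plus the remainder, and the
-- remainder is less than d.
remainder-halves : ∀ a d .{{_ : NonZero d}} → d ≤ a → a % d + a % d < a
remainder-halves a d d≤a = begin-strict
  a % d + a % d         <⟨ +-monoʳ-< (a % d) (m%n<n a d) ⟩
  a % d + d             ≤⟨ +-monoʳ-≤ (a % d) (m≤n*m d (a / d) {{>-nonZero (m≥n⇒m/n>0 d≤a)}}) ⟩
  a % d + (a / d) * d   ≡⟨ sym (m≡m%n+[m/n]*n a d) ⟩
  a                     ∎
  where open ≤-Reasoning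

-- Each half of `IsMiddle` bounds one side: α ≤ 2(L + a) gives R ≤ L + a, and 2L < α gives L ≤ R +
-- a.
middle-difference : ∀ αs m → IsMiddle αs m → ∣ leftOf αs m - rightOf αs m ∣ ≤ lookup αs m
middle-difference αs m (lo , hi) with ≤-total (leftOf αs m) (rightOf αs m)
... | inj₁ L≤R = subst (_≤ a) (sym (m≤n⇒∣m-n∣≡n∸m L≤R)) (m≤n+o⇒m∸n≤o R L
  (+-cancelˡ-≤ (L + a) R (L + a) (begin
    L + a + R          ≡⟨ sym (sum-split αs m) ⟩
    sum αs             ≤⟨ hi ⟩
    2 * sum (take (suc (toℕ m)) αs) ≡⟨ cong (2 *_) (sum-take-suc αs m) ⟩
    2 * (L + a)        ≡⟨ sym (doubling (L + a)) ⟩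
    L + a + (L + a)    ∎)))
  where
  open ≤-Reasoning
  L R a : ℕ
  L = leftOf αs m
  R = rightOf αs m
  a = lookup αs m
... | inj₂ R≤L = subst (_≤ a) (sym (m≤n⇒∣n-m∣≡n∸m R≤L)) (m≤n+o⇒m∸n≤o L R
  (+-cancelˡ-≤ L L (R + a) (begin
    L + L              ≡⟨ doubling L ⟩
    2 * L              ≤⟨ <⇒≤ lo ⟩
    sum αs             ≡⟨ sum-split αs m ⟩
    L + a + R          ≡⟨ rotate L a R ⟩
    L + (R + a)        ∎)))
  where
  open ≤-Reasoning
  L R a : ℕ
  L = leftOf αs m
  R = rightOf αs m
  a = lookup αs m
  rotate : ∀ l a r → l + a + r ≡ l + (r + a)
  rotate = solve-∀

-- Nonzero entries guarantee a middle family for the next pass, the length bounds the cost of a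
-- pass, and the bits bound the number of passes.
Simpler : List ℕ → List ℕ → Set
Simpler βs αs = All NonZero βs × length βs ≤ length αs × bits βs < bits αs

removal-simpler : ∀ ls {a rs} → All NonZero (ls ++ a ∷ rs) → Simpler (ls ++ rs) (ls ++ a ∷ rs)
removal-simpler []       {a} (a≢0 ∷ rs≢0) = rs≢0 , n≤1+n _ , m<n+m _ (bits-positive a {{a≢0}})
removal-simpler (x ∷ ls) (x≢0 ∷ αs≢0) with removal-simpler ls αs≢0
... | βs≢0 , shorter , fewer = x≢0 ∷ βs≢0 , s≤s shorter , +-monoʳ-< ⌈log₂ suc x ⌉ fewer

replacement-simpler : ∀ ls {a r rs} → NonZero r → ⌈log₂ suc r ⌉ < ⌈log₂ suc a ⌉ →
                      All NonZero (ls ++ a ∷ rs) → Simpler (ls ++ r ∷ rs) (ls ++ a ∷ rs)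
replacement-simpler []       {rs = rs} r≢0 r<a (_ ∷ rs≢0) =
  r≢0 ∷ rs≢0 , ≤-refl , +-monoˡ-< (bits rs) r<a
replacement-simpler (x ∷ ls) r≢0 r<a (x≢0 ∷ αs≢0) with replacement-simpler ls r≢0 r<a αs≢0
... | βs≢0 , shorter , fewer = x≢0 ∷ βs≢0 , s≤s shorter , +-monoʳ-< ⌈log₂ suc x ⌉ fewer

reduction-simpler : ∀ {ls a rs βs d} → ∣ sum ls - sum rs ∣ ≤ a → All NonZero (ls ++ a ∷ rs) →
                    Reduction ls a rs (βs , d) → Simpler βs (ls ++ a ∷ rs)
reduction-simpler {ls}     _   αs≢0 (balanced _)      = removal-simpler ls αs≢0
reduction-simpler {ls}     _   αs≢0 (divisible _ _)   = removal-simpler ls αs≢0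
reduction-simpler {ls} {a} {rs} d≤a αs≢0 (remainder _ r≢0) =
  replacement-simpler ls (≢-nonZero r≢0) (bits-halve (a % ∣ sum ls - sum rs ∣)
    (remainder-halves a _ d≤a)) αs≢0

reduce-simpler : ∀ αs m → IsMiddle αs m → All NonZero αs → Simpler (proj₁ (reduce αs m)) αs
reduce-simpler αs m isMiddle αs≢0 = subst (Simpler _) (split-at αs m)
  (reduction-simpler (middle-difference αs m isMiddle) (subst (All NonZero) (sym (split-at αs m)) αs≢0)
    (reduction αs m))

-- The bound `b` on the bits makes the recursion structural. A pass costs at most `8 * length αs`,
-- which is paid for by the bit it removes.
halts : ∀ b αs z → All NonZero αs → bits αs ≤ b →
        ∃[ c ] Loop step (αs , z) (𝒵 αs + z) c × c ≤ 8 * (bits αs * length αs)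
-- `𝒵 []` computes to 0, and leaving the loop takes no integer operation.
halts b [] z _ _ = 0 , exit return , z≤n
-- A nonzero entry has at least one bit, so the bound cannot run out before the list is empty.
halts zero (x ∷ xs) z (x≢0 ∷ _) bits≤0 =
  contradiction (≤-trans (m≤m+n _ (bits xs)) bits≤0) (<⇒≱ (bits-positive x {{x≢0}}))
halts (suc b) αs@(_ ∷ _) z αs≢0 bits≤ with existsUniqueMiddle αs αs≢0 (s≤s z≤n)
... | m , isMiddle , _ with reduce αs m | reduction αs m | 𝒵-reduce αs m | reduce-simpler αs m isMiddle αs≢0
... | βs , d | red | 𝒵≡ | βs≢0 , shorter , fewer
  with step-runs αs m z isMiddle red | halts b βs (z + d) βs≢0 (s≤s⁻¹ (≤-trans fewer bits≤))
... | c , run , c≤ | c′ , loop , c′≤ =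
  c + c′ , next run (subst (λ v → Loop step (βs , z + d) v c′) value loop) , (begin
    c + c′
      ≤⟨ +-mono-≤ c≤ c′≤ ⟩
    8 * length αs + 8 * (bits βs * length βs)
      ≡⟨ sym (*-distribˡ-+ 8 (length αs) _) ⟩
    8 * (length αs + bits βs * length βs)
      ≤⟨ *-monoʳ-≤ 8 (+-monoʳ-≤ (length αs) (*-monoʳ-≤ (bits βs) shorter)) ⟩
    8 * (suc (bits βs) * length αs)
      ≤⟨ *-monoʳ-≤ 8 (*-monoˡ-≤ (length αs) fewer) ⟩
    8 * (bits αs * length αs)
      ∎)
  where
  open ≤-Reasoning
  commute : ∀ v z d → v + (z + d) ≡ v + d + z
  commute = solve-∀
  value : 𝒵 βs + (z + d) ≡ 𝒵 αs + z
  value = trans (commute (𝒵 βs) z d) (cong (_+ z) (sym 𝒵≡))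

theorem6p3 : ((αs : List ℕ) → All NonZero αs → (m : Fin (length αs)) → IsMiddle αs m →
    let (βs , d) = reduce αs m in
    (𝒵 αs ≡ 𝒵 βs + d)
    × ((z : ℕ) → ∃[ c ] (step (αs , z) ⇓ inj₂ (βs , z + d) ⟨ c ⟩)))
    × (∃[ C ] ((αs : List ℕ) → All NonZero αs → 1 ≤ length αs →
    ∃[ c ] (Computes αs (𝒵 αs) c × c ≤ C * (bits αs * length αs))))
theorem6p3 =
    (λ αs _ m isMiddle → 𝒵-reduce αs m , λ z →
      let (c , run , _) = step-runs αs m z isMiddle (reduction αs m) in c , run)
  , 8 , λ αs αs≢0 _ →
      let (c , loop , c≤) = halts (bits αs) αs 0 αs≢0 ≤-refl
      in c , subst (λ v → Computes αs v c) (+-identityʳ (𝒵 αs)) loop , c≤
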